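{- Let $q$ be a power of the prime $p$, $n$ a positive integer, $a\in\mathbb{F}_q$ with $a^n=1$, and $\delta\in\mathbb{F}_{q^n}$ nonzero with $\delta^q=a\delta$. Let $L_{g_a}(x)=x^{q^{n-1}}+a x^{q^{n-2}}+\cdots+a^{n-1}x$ (the linearized $q$-associate of $g_a(x)=\frac{x^n-1}{x-a}$). Let $f(x)=\sum_{i=0}^m a_i x^i\in\mathbb{F}_{q^n}[x]$, $h\in\mathbb{F}_q[x]$, and $k\in\mathbb{F}_{q^n}[x]$ with $k(\delta\mathbb{F}_q)\subseteq\mathbb{F}_q^*$, and let $P(x)=f(L_{g_a}(x))+k(L_{g_a}(x))\cdot L_h(x)$. Then $P$ is a permutation polynomial of $\mathbb{F}_{q^n}$ if and only if: (1) $\gcd\left(h(x),\frac{x^n-1}{x-a}\right)=1$; and (2) $\bar{Q}_a(x)=\frac{1}{a}\sum_{i=0}^m\mathrm{Tr}_{q^n/q}(\delta^{i-1}a_i)x^i+k(\delta x)h(a)x$ induces a permutation of $\mathbb{F}_q$. Moreover, in this case, if $R$ induces the inverse permutation of $\bar{Q}_a$ on $\mathbb{F}_q$, then the inverse of the permutation of $\mathbb{F}_{q^n}$ induced by $P$ is induced by $$P_0(x)=F(\delta^{ -1}L_{g_a}(x))+k(\delta R(\delta^{ -1}L_{g_a}(x)))^{q-2}\cdot L_H(x),$$ where $H\in\mathbb{F}_q[x]$ and $F\in\mathbb{F}_{q^n}[x]$ are as follows: (i) if $p\mid n$: $H$ is the unique polynomial of degree at most $n-1$ with $h(x)H(x)\equiv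 1\pmod{x^n-1}$ (such $H$ exists, since when $p\mid n$ condition (1) is equivalent to $\gcd(h(x),x^n-1)=1$), and $F$ is any polynomial with $F(x)\equiv -k(\delta R(x))^{q-2}\cdot L_H(f(\delta R(x)))\pmod{x^q-x}$; (ii) if $p\nmid n$: $H$ is the unique polynomial of degree at most $n-2$ with $h(x)H(x)\equiv 1\pmod{\frac{x^n-1}{x-a}}$, and $F$ is any polynomial with $F(x)\equiv M(\delta R(x))\pmod{x^q-x}$, where $M(x)=-k(x)^{q-2}\cdot L_H(f(x))+a x\cdot\frac{1-h(a)H(a)}{n}$.
   Context: For $u(x)=\sum_{i=0}^m c_i x^i\in\mathbb{F}_q[x]$, its linearized $q$-associate is $L_u(x)=\sum_{i=0}^m c_i x^{q^i}$. $\mathrm{Tr}_{q^n/q}(x)=x+x^q+\cdots+x^{q^{n-1}}$. A permutation polynomial of a finite field is a polynomial inducing a bijection of it. -}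

module Defs where

open import Level using (Level; _⊔_) renaming (suc to lsuc)
open import Data.Nat.Base as ℕ using (ℕ; zero; suc; _∸_; _≤_)
open import Data.Fin.Base using (Fin; toℕ)
import Data.Fin.Properties as Fin
open import Data.List.Base using (List; []; _∷_; map; length; lookup; applyDownFrom)
open import Data.Product.Base using (∃; ∃₂; _×_; _,_; proj₁; proj₂)
open import Relation.Nullary.Decidable using (Dec; yes; no; map′)
open import Relation.Nullary.Negation using (contradiction)
open import Relation.Binary.Definitions using (Decidable)
import Relation.Binary.PropositionalEquality as ≡
open import Function.Bundles using (Inverse)
open import Function.Definitions using (Bijective; Inverseᵇ)
open import Algebra.Bundles using (RawRing; CommutativeRing)
open import Algebra.Apartness.Bundles using (HeytingField; HeytingCommutativeRing)
import Algebra.Definitions.RawSemiring as RawSemiringDefinitions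
import Algebra.Properties.Ring as RingProperties
open import Algebra.Morphism.Structures using (module RingMorphisms)

-- A polynomial is its list of coefficients, constant term first.  Trailing
-- zeros are allowed, so equality of polynomials is equality of all
-- coefficients, the missing ones being read as 0#.

module Polynomial {c ℓ} (R : RawRing c ℓ) where

  private module R where
    open RawRing R public
    open RawSemiringDefinitions rawSemiring public using (_^_; sum)

  infixl 6 _+_
  infixl 7 _*_
  infix  8 -_
  infix  4 _≈_
  infixr 9 _∘_

  Poly : Set c
  Poly = List R.Carrier

  coeff : Poly → ℕ → R.Carrier
  coeff []      _       = R.0#
  coeff (a ∷ u) zero    = a
  coeff (a ∷ u) (suc i) = coeff u i

  _≈_ : Poly → Poly → Set ℓ
  u ≈ v = ∀ i → coeff u i R.≈ coeff v i

  _+_ : Poly → Poly → Poly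
  []      + v       = v
  (a ∷ u) + []      = a ∷ u
  (a ∷ u) + (b ∷ v) = (a R.+ b) ∷ (u + v)

  -_ : Poly → Poly
  -_ = map R.-_

  _*_ : Poly → Poly → Poly
  []      * v = []
  (a ∷ u) * v = map (a R.*_) v + (R.0# ∷ u * v)

  C : R.Carrier → Poly
  C a = a ∷ []

  X : Poly
  X = R.0# ∷ R.1# ∷ []

  rawRing : RawRing c ℓ
  rawRing = record
    { Carrier = Poly ; _≈_ = _≈_ ; _+_ = _+_ ; _*_ = _*_ ; -_ = -_
    ; 0# = [] ; 1# = C R.1# }

  open RawRing rawRing public using (0#; 1#)
  open RawSemiringDefinitions (RawRing.rawSemiring rawRing) public
    using (_^_; sum; _∣_; Coprime)

  infixl 6 _-_
  _-_ : Poly → Poly → Poly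
  u - v = u + (- v)

  _≡_[mod_] : Poly → Poly → Poly → Set (c ⊔ ℓ)
  u ≡ v [mod w ] = w ∣ (u - v)

  -- The zero polynomial is the only one of degree below 0.
  DegreeBelow : ℕ → Poly → Set ℓ
  DegreeBelow d u = ∀ i → d ≤ i → coeff u i R.≈ R.0#

  eval : Poly → R.Carrier → R.Carrier
  eval []      x = R.0#
  eval (a ∷ u) x = a R.+ x R.* eval u x

  _∘_ : Poly → Poly → Poly
  []      ∘ v = []
  (a ∷ u) ∘ v = C a + v * (u ∘ v)

  -- The linearized q-associate Σ cᵢ X^(qⁱ) of Σ cᵢ Xⁱ.
  linearized : ℕ → Poly → Poly
  linearized q u =
    sum {length u} λ i → C (lookup u i) * X ^ (q ℕ.^ toℕ i)

  -- The quotient (Xⁿ - 1) / (X - a) for aⁿ = 1, written out as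
  -- aⁿ⁻¹ + aⁿ⁻² X + ⋯ + Xⁿ⁻¹; see quotient-correct below.
  quotient : ℕ → R.Carrier → Poly
  quotient n a = applyDownFrom (a R.^_) n

module _ {c ℓ} (R : CommutativeRing c ℓ) where

  private
    module P = Polynomial (CommutativeRing.rawRing R)
  open CommutativeRing R
  open RawSemiringDefinitions (RawRing.rawSemiring rawRing) using (_^_)
  open RingProperties ring using (-0#≈0#; -‿distribˡ-*)
  open import Relation.Binary.Reasoning.Setoid setoid

  private
    coeff-+ : ∀ u v i → P.coeff (u P.+ v) i ≈ P.coeff u i + P.coeff v i
    coeff-+ []      v       i       = sym (+-identityˡ _)
    coeff-+ (a ∷ u) []      i       = sym (+-identityʳ _)
    coeff-+ (a ∷ u) (b ∷ v) zero    = refl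
    coeff-+ (a ∷ u) (b ∷ v) (suc i) = coeff-+ u v i

    coeff-neg : ∀ u i → P.coeff (P.- u) i ≈ - P.coeff u i
    coeff-neg []      i       = sym -0#≈0#
    coeff-neg (a ∷ u) zero    = refl
    coeff-neg (a ∷ u) (suc i) = coeff-neg u i

    coeff-- : ∀ u v i → P.coeff (u P.- v) i ≈ P.coeff u i - P.coeff v i
    coeff-- u v i = trans (coeff-+ u (P.- v) i) (+-congˡ (coeff-neg v i))

    coeff-scale : ∀ a u i → P.coeff (map (a *_) u) i ≈ a * P.coeff u i
    coeff-scale a []      i       = sym (zeroʳ a)
    coeff-scale a (b ∷ u) zero    = refl
    coeff-scale a (b ∷ u) (suc i) = coeff-scale a u i

    pad : ∀ i → P.coeff (0# ∷ []) i ≈ 0#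
    pad zero    = refl
    pad (suc i) = refl

    coeff-C* : ∀ b u i → P.coeff (P.C b P.* u) i ≈ b * P.coeff u i
    coeff-C* b u i = begin
      P.coeff (map (b *_) u P.+ (0# ∷ [])) i              ≈⟨ coeff-+ (map (b *_) u) _ i ⟩
      P.coeff (map (b *_) u) i + P.coeff (0# ∷ []) i      ≈⟨ +-cong (coeff-scale b u i) (pad i) ⟩
      b * P.coeff u i + 0#                                ≈⟨ +-identityʳ _ ⟩
      b * P.coeff u i                                     ∎

    linear-zero : ∀ b d u → P.coeff ((b ∷ d ∷ []) P.* u) 0 ≈ b * P.coeff u 0
    linear-zero b d u = begin
      P.coeff (map (b *_) u P.+ (0# ∷ P.C d P.* u)) 0  ≈⟨ coeff-+ (map (b *_) u) _ 0 ⟩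
      P.coeff (map (b *_) u) 0 + 0#                    ≈⟨ +-identityʳ _ ⟩
      P.coeff (map (b *_) u) 0                         ≈⟨ coeff-scale b u 0 ⟩
      b * P.coeff u 0                                  ∎

    linear-suc : ∀ b d u i →
      P.coeff ((b ∷ d ∷ []) P.* u) (suc i) ≈ b * P.coeff u (suc i) + d * P.coeff u i
    linear-suc b d u i = begin
      P.coeff (map (b *_) u P.+ (0# ∷ P.C d P.* u)) (suc i)
        ≈⟨ coeff-+ (map (b *_) u) _ (suc i) ⟩
      P.coeff (map (b *_) u) (suc i) + P.coeff (P.C d P.* u) i
        ≈⟨ +-cong (coeff-scale b u (suc i)) (coeff-C* d u i) ⟩
      b * P.coeff u (suc i) + d * P.coeff u i ∎

    X*-zero : ∀ u → P.coeff (P.X P.* u) 0 ≈ 0#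
    X*-zero u = trans (linear-zero 0# 1# u) (zeroˡ _)

    X*-suc : ∀ u i → P.coeff (P.X P.* u) (suc i) ≈ P.coeff u i
    X*-suc u i = begin
      P.coeff (P.X P.* u) (suc i)                 ≈⟨ linear-suc 0# 1# u i ⟩
      0# * P.coeff u (suc i) + 1# * P.coeff u i   ≈⟨ +-cong (zeroˡ _) (*-identityˡ _) ⟩
      0# + P.coeff u i                            ≈⟨ +-identityˡ _ ⟩
      P.coeff u i                                 ∎

    module _ (a : Carrier) where

      factor : P.Poly
      factor = P.X P.- P.C a

      factor-zero : ∀ u → P.coeff (factor P.* u) 0 ≈ - (a * P.coeff u 0)
      factor-zero u = begin
        P.coeff (factor P.* u) 0     ≈⟨ linear-zero (0# + - a) 1# u ⟩
        (0# + - a) * P.coeff u 0     ≈⟨ *-congʳ (+-identityˡ _) ⟩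
        - a * P.coeff u 0            ≈⟨ sym (-‿distribˡ-* a _) ⟩
        - (a * P.coeff u 0)          ∎

      factor-suc : ∀ u i →
        P.coeff (factor P.* u) (suc i) ≈ - (a * P.coeff u (suc i)) + P.coeff u i
      factor-suc u i = begin
        P.coeff (factor P.* u) (suc i)
          ≈⟨ linear-suc (0# + - a) 1# u i ⟩
        (0# + - a) * P.coeff u (suc i) + 1# * P.coeff u i
          ≈⟨ +-cong (*-congʳ (+-identityˡ _)) (*-identityˡ _) ⟩
        - a * P.coeff u (suc i) + P.coeff u i
          ≈⟨ +-congʳ (sym (-‿distribˡ-* a _)) ⟩
        - (a * P.coeff u (suc i)) + P.coeff u i ∎

      minus-zero : ∀ x → x - 0# ≈ x
      minus-zero x = trans (+-congˡ -0#≈0#) (+-identityʳ x)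

      factor-quotient : ∀ n i →
        P.coeff (factor P.* P.quotient n a) i ≈
        P.coeff (P.X P.^ n) i - P.coeff (P.C (a ^ n)) i
      factor-quotient zero zero = begin
        P.coeff (factor P.* []) 0  ≈⟨ factor-zero [] ⟩
        - (a * 0#)                 ≈⟨ -‿cong (zeroʳ a) ⟩
        - 0#                       ≈⟨ -0#≈0# ⟩
        0#                         ≈⟨ sym (-‿inverseʳ 1#) ⟩
        1# - 1#                    ∎
      factor-quotient zero (suc i) = begin
        P.coeff (factor P.* []) (suc i)  ≈⟨ factor-suc [] i ⟩
        - (a * 0#) + 0#                  ≈⟨ +-congʳ (-‿cong (zeroʳ a)) ⟩
        - 0# + 0#                        ≈⟨ +-comm _ _ ⟩
        0# - 0#                          ∎
      factor-quotient (suc n) zero = begin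
        P.coeff (factor P.* P.quotient (suc n) a) 0  ≈⟨ factor-zero (P.quotient (suc n) a) ⟩
        - (a * a ^ n)                                ≈⟨ sym (+-identityˡ _) ⟩
        0# - a ^ suc n                               ≈⟨ +-congʳ (sym (X*-zero (P.X P.^ n))) ⟩
        P.coeff (P.X P.^ suc n) 0 - a ^ suc n        ∎
      factor-quotient (suc n) (suc zero) = begin
        P.coeff (factor P.* P.quotient (suc n) a) 1
          ≈⟨ factor-suc (P.quotient (suc n) a) 0 ⟩
        - (a * P.coeff (P.quotient n a) 0) + a ^ n
          ≈⟨ +-congʳ (sym (factor-zero (P.quotient n a))) ⟩
        P.coeff (factor P.* P.quotient n a) 0 + a ^ n
          ≈⟨ +-congʳ (factor-quotient n 0) ⟩
        P.coeff (P.X P.^ n) 0 - a ^ n + a ^ n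
          ≈⟨ trans (+-assoc _ _ _) (+-congˡ (-‿inverseˡ _)) ⟩
        P.coeff (P.X P.^ n) 0 + 0#
          ≈⟨ +-cong (sym (X*-suc (P.X P.^ n) 0)) (sym -0#≈0#) ⟩
        P.coeff (P.X P.^ suc n) 1 - 0# ∎
      factor-quotient (suc n) (suc (suc i)) = begin
        P.coeff (factor P.* P.quotient (suc n) a) (suc (suc i))
          ≈⟨ factor-suc (P.quotient (suc n) a) (suc i) ⟩
        - (a * P.coeff (P.quotient n a) (suc i)) + P.coeff (P.quotient n a) i
          ≈⟨ sym (factor-suc (P.quotient n a) i) ⟩
        P.coeff (factor P.* P.quotient n a) (suc i)
          ≈⟨ factor-quotient n (suc i) ⟩
        P.coeff (P.X P.^ n) (suc i) - 0#
          ≈⟨ +-congʳ (sym (X*-suc (P.X P.^ n) (suc i))) ⟩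
        P.coeff (P.X P.^ suc n) (suc (suc i)) - 0# ∎

  quotient-correct : ∀ n {a} → a ^ n ≈ 1# →
    (P.X P.- P.C a) P.* P.quotient n a P.≈ P.X P.^ n P.- P.1#
  quotient-correct n {a} aⁿ≈1 i = begin
    P.coeff ((P.X P.- P.C a) P.* P.quotient n a) i   ≈⟨ factor-quotient a n i ⟩
    P.coeff (P.X P.^ n) i - P.coeff (P.C (a ^ n)) i  ≈⟨ +-congˡ (-‿cong (C-cong i)) ⟩
    P.coeff (P.X P.^ n) i - P.coeff P.1# i           ≈⟨ sym (coeff-- (P.X P.^ n) P.1# i) ⟩
    P.coeff (P.X P.^ n P.- P.1#) i                   ∎
    where
    C-cong : P.C (a ^ n) P.≈ P.1#
    C-cong zero    = aⁿ≈1
    C-cong (suc i) = refl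

record FiniteField c ℓ₁ ℓ₂ (N : ℕ) : Set (lsuc (c ⊔ ℓ₁ ⊔ ℓ₂)) where
  field
    heytingField : HeytingField c ℓ₁ ℓ₂

  open HeytingField heytingField public
    using (Carrier; _≈_; _#_; _+_; _*_; -_; _-_; 0#; 1#; #⇒invertible; heytingCommutativeRing)
  open HeytingCommutativeRing heytingCommutativeRing public
    using (commutativeRing)
  open CommutativeRing commutativeRing public using (setoid; rawRing)
  open RawSemiringDefinitions (RawRing.rawSemiring rawRing) public
    using (_^_; sum) renaming (_×_ to _·_)

  field
    enumeration : Inverse (≡.setoid (Fin N)) setoid

  private
    module R = CommutativeRing commutativeRing
    module E = Inverse enumeration

  _≟_ : Decidable _≈_
  x ≟ y = map′ (λ eq → R.trans (R.sym (E.strictlyInverseˡ x))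
                         (R.trans (R.reflexive (≡.cong E.to eq)) (E.strictlyInverseˡ y)))
               E.from-cong
               (E.from x Fin.≟ E.from y)

  invertible? : ∀ x → Dec (∃ λ i → x * E.to i ≈ 1#)
  invertible? x = Fin.any? λ i → (x * E.to i) ≟ 1#

  -- The multiplicative inverse, made total by setting 0# ⁻¹ = 0#.
  infix 9 _⁻¹
  _⁻¹ : Carrier → Carrier
  x ⁻¹ with invertible? x
  ... | yes (i , _) = E.to i
  ... | no _        = 0#

  ⁻¹-inverseʳ : ∀ {x} → x # 0# → x * x ⁻¹ ≈ 1#
  ⁻¹-inverseʳ {x} x#0 with invertible? x
  ... | yes (_ , eq) = eq
  ... | no ∄y        = contradiction (E.from y , eq) ∄y
    where
    inv = #⇒invertible x#0
    y   = proj₁ inv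
    eq : x * E.to (E.from y) ≈ 1#
    eq = R.trans (R.*-cong
           (R.sym (R.trans (R.+-congˡ (RingProperties.-0#≈0# R.ring)) (R.+-identityʳ x)))
           (E.strictlyInverseˡ y)) (proj₂ (proj₂ inv))

-- 𝔽_q ⊆ 𝔽_{qⁿ}, the inclusion being the embedding ι.
record FiniteFieldExtension c₁ ℓ₁ ℓ₁′ c₂ ℓ₂ ℓ₂′ (q n : ℕ)
       : Set (lsuc (c₁ ⊔ ℓ₁ ⊔ ℓ₁′ ⊔ c₂ ⊔ ℓ₂ ⊔ ℓ₂′)) where
  field
    base : FiniteField c₁ ℓ₁ ℓ₁′ q
    top  : FiniteField c₂ ℓ₂ ℓ₂′ (q ℕ.^ n)
    ι    : FiniteField.Carrier base → FiniteField.Carrier top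

  open RingMorphisms (FiniteField.rawRing base) (FiniteField.rawRing top)

  field
    ι-isRingMonomorphism : IsRingMonomorphism ι

module Extension {c₁ ℓ₁ ℓ₁′ c₂ ℓ₂ ℓ₂′ q n}
         (E : FiniteFieldExtension c₁ ℓ₁ ℓ₁′ c₂ ℓ₂ ℓ₂′ q n) where

  open FiniteFieldExtension E public using (ι)

  module F    = FiniteField (FiniteFieldExtension.base E)
  module K    = FiniteField (FiniteFieldExtension.top E)
  module F[x] = Polynomial F.rawRing
  module K[x] = Polynomial K.rawRing

  Tr : K.Carrier → K.Carrier
  Tr x = K.sum {n} λ i → x K.^ (q ℕ.^ toℕ i)

  -- The linearized q-associate of a polynomial over 𝔽_q, regarded as a
  -- polynomial over 𝔽_{qⁿ}.
  L : F[x].Poly → K[x].Poly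
  L u = map ι (F[x].linearized q u)

  IsPermutationPolynomial : K[x].Poly → Set (c₂ ⊔ ℓ₂)
  IsPermutationPolynomial u = Bijective K._≈_ K._≈_ (K[x].eval u)

  InducesInverse : K[x].Poly → K[x].Poly → Set (c₂ ⊔ ℓ₂)
  InducesInverse u v = Inverseᵇ K._≈_ K._≈_ (K[x].eval u) (K[x].eval v)

  InducesOnF : K[x].Poly → (F.Carrier → F.Carrier) → Set (c₁ ⊔ ℓ₂)
  InducesOnF u φ = ∀ y → K[x].eval u (ι y) K.≈ ι (φ y)

  InducesPermutationOfF : K[x].Poly → Set (c₁ ⊔ ℓ₁ ⊔ ℓ₂)
  InducesPermutationOfF u =
    ∃ λ φ → InducesOnF u φ × Bijective F._≈_ F._≈_ φ

  InducesInverseOnF : K[x].Poly → K[x].Poly → Set (c₁ ⊔ ℓ₁ ⊔ ℓ₂)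
  InducesInverseOnF u v =
    ∃₂ λ φ ψ → InducesOnF u φ × InducesOnF v ψ × Inverseᵇ F._≈_ F._≈_ φ ψ

  open K[x]

  g : F.Carrier → F[x].Poly
  g a = F[x].quotient n a

  P : F.Carrier → Poly → F[x].Poly → Poly → Poly
  P a f h k = f ∘ L (g a) + (k ∘ L (g a)) * L h

  -- The power δⁱ⁻¹ is written δⁱ δ⁻¹, so that i = 0 is covered.
  Q̄ : F.Carrier → K.Carrier → Poly → F[x].Poly → Poly → Poly
  Q̄ a δ f h k =
    C (ι a K.⁻¹) *
      sum {length f} (λ i → C (Tr (δ K.^ toℕ i K.* δ K.⁻¹ K.* lookup f i)) * X ^ toℕ i)
    + (k ∘ (C δ * X)) * C (ι (F[x].eval h a)) * X

  P₀ : F.Carrier → K.Carrier → Poly → F[x].Poly → Poly → Poly → Poly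
  P₀ a δ k H F R =
    F ∘ y + (k ∘ (C δ * (R ∘ y))) ^ (q ∸ 2) * L H
    where y = C (δ K.⁻¹) * L (g a)

  M : F.Carrier → Poly → F[x].Poly → Poly → F[x].Poly → Poly
  M a f h k H =
    - (k ^ (q ∸ 2)) * (L H ∘ f)
    + C (ι a) * X
      * C (ι ((F.1# F.- F[x].eval h a F.* F[x].eval H a) F.* (n F.· F.1#) F.⁻¹))

module Submission where

-- Let σ be the q-power map.  The operators Λ u = Σ uᵢ σⁱ on 𝔽_{qⁿ} multiply like polynomials modulo
-- xⁿ - 1, and they are linearly independent in degree below n.  Since (σ - a) G = 0 for G = Λ (g a),
-- the image of G is the eigenspace δ𝔽_q, on which Λ u is multiplication by u(a).  Hence G ∘ P = Q̄ ∘ G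
-- in the coordinate t on δ𝔽_q, and P permutes 𝔽_{qⁿ} iff Q̄ permutes 𝔽_q and Λ h is injective on ker G.
-- The latter is coprimality: one direction is Bézout; conversely, if d divides h and g a then Λ d is
-- injective, so surjective, and the cofactor of d in xⁿ - 1 acts as 0, which forces d to be a unit.
-- Finally P₀ (P x) = F(Q̄ t) + k⁻¹ L_H(f(δt)) + Λ (h H) x, where hH ≡ 1 evaluates the last term.

open import Defs
open import Level using (Level; _⊔_)
open import Data.Nat.Base using (ℕ; _<_; _∸_) renaming (_^_ to _^ℕ_)
open import Data.Nat.Base as ℕ using (zero; suc; z≤n; s≤s)
import Data.Nat.Properties as ℕ
open import Data.Nat.Divisibility using (_∣_; _∤_)
import Data.Nat.Divisibility as ℕ∣
import Data.Nat.DivMod as ℕ/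
open import Data.Nat.Primality using
  (Prime; ¬prime[0]; prime⇒nonTrivial; prime⇒irreducible; euclidsLemma)
open import Data.Nat.Combinatorics using (_C_; nCn≡1; nCk≡n!/k![n-k]!; k![n∸k]!∣n!)
open import Data.Nat.Coprimality using (Coprime; coprime-Bézout)
open import Data.Nat.GCD using (module Bézout)
open import Data.Fin.Base using (Fin; zero; suc; toℕ; fromℕ; inject₁; punchOut)
import Data.Fin.Properties as Fin
open import Data.Fin.Permutation using (Permutation′; permutation)
open import Data.List.Base using ([]; _∷_; map; length; lookup)
open import Data.Vec.Functional using (Vector; removeAt; replicate)
open import Data.Product using (∃; ∃!; ∃₂; _×_; _,_; proj₁; proj₂)
open import Data.Sum.Base using (_⊎_; inj₁; inj₂)
open import Function.Base using (case_of_) renaming (_∘_ to _⊙_)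
open import Function.Bundles using (Inverse; _⇔_; mk⇔; Equivalence)
open import Function.Definitions using (Congruent; Injective; StrictlySurjective; Inverseᵇ)
open import Relation.Nullary using (¬_; ¬?; Dec; yes; no; contradiction; decidable-stable)
open import Relation.Binary.Bundles using (Setoid)
open import Relation.Binary.Definitions using (tri<; tri≈; tri>)
open import Relation.Binary.PropositionalEquality using (_≡_; _≢_)
import Relation.Binary.PropositionalEquality as ≡
import Relation.Binary.Reasoning.Setoid as SetoidReasoning
open import Algebra.Bundles using (CommutativeRing; CommutativeMonoid)
open import Algebra.Apartness.Bundles using (HeytingField)
open import Algebra.Definitions.RawMagma using (_,_)
open import Algebra.Morphism.Structures using (module RingMorphisms)
import Algebra.Properties.CommutativeMonoid.Sum as Sum
import Algebra.Properties.CommutativeSemiring.Binomial as Binomial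
import Algebra.Properties.CommutativeSemiring.Exp as CommutativeExp
import Algebra.Properties.Ring as RingProperties
import Algebra.Properties.Semiring.Exp as Exp
import Algebra.Properties.Semiring.Mult as Mult
import Algebra.Properties.Semiring.Sum as SemiringSum
import Algebra.Solver.Ring.NaturalCoefficients.Default as SemiringSolver

-- The two cases for p and n come from `a * g(a) = n`: on the eigenspace G is multiplication by g(a)
-- = n/a. If p divides n, the image of G lies in its kernel, so injectivity of `Λ h` on that kernel
-- spreads to the whole field, h is invertible modulo xⁿ - 1, and `Λ (h * H)` is the identity.
-- Otherwise h may vanish at a, and only an inverse modulo g_a is available. Then h H = 1 + e g_a,
-- so `Λ (h * H)` sends x to x + e(a) G x: the error depends on the coordinate t alone, and F can
-- correct it. Evaluation at a gives e(a) = - a (1 - h(a) H(a)) / n, the origin of the linear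
-- summand of `M`. The hypothesis on k is used twice: values in 𝔽_q pass through the 𝔽_q-linear
-- operators, and nonzero ones are inverted by the power q - 2.

-- The ring of polynomials, evaluation and coefficients.

module PolynomialRing {c ℓ} (R : CommutativeRing c ℓ) where

  open CommutativeRing R hiding (zero)
  open RingProperties ring using (-0#≈0#)
  open SemiringSolver commutativeSemiring using (solve; _:=_; _:+_)
  private module P = Polynomial rawRing
  open P using (Poly; coeff)

  infix 4 _≋_

  -- Unlike P._≈_, which unfolds to a Π-type, this record type lets Agda infer u and v.
  record _≋_ (u v : Poly) : Set ℓ where
    constructor pointwise
    field at : u P.≈ v
  open _≋_ public

  coeff-+ : ∀ u v i → coeff (u P.+ v) i ≈ coeff u i + coeff v i
  coeff-+ []      v       i       = sym (+-identityˡ _)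
  coeff-+ (a ∷ u) []      i       = sym (+-identityʳ _)
  coeff-+ (a ∷ u) (b ∷ v) zero    = refl
  coeff-+ (a ∷ u) (b ∷ v) (suc i) = coeff-+ u v i

  coeff-neg : ∀ u i → coeff (P.- u) i ≈ - coeff u i
  coeff-neg []      i       = sym -0#≈0#
  coeff-neg (a ∷ u) zero    = refl
  coeff-neg (a ∷ u) (suc i) = coeff-neg u i

  scale : Carrier → Poly → Poly
  scale a = map (a *_)

  coeff-scale : ∀ a u i → coeff (scale a u) i ≈ a * coeff u i
  coeff-scale a []      i       = sym (zeroʳ a)
  coeff-scale a (b ∷ u) zero    = refl
  coeff-scale a (b ∷ u) (suc i) = coeff-scale a u i

  private
    ≈-setoid : Setoid c ℓ
    ≈-setoid = record
      { Carrier = Poly ; _≈_ = _≋_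
      ; isEquivalence = record
        { refl = pointwise λ i → refl
        ; sym = λ p → pointwise λ i → sym (at p i)
        ; trans = λ p q → pointwise λ i → trans (at p i) (at q i) } }

    module ≈ = Setoid ≈-setoid

  ∷-cong : ∀ {a b u v} → a ≈ b → u ≋ v → (a ∷ u) ≋ (b ∷ v)
  ∷-cong a≈b u≈v = pointwise λ { zero → a≈b ; (suc i) → at u≈v i }

  0∷0≈0 : (0# ∷ []) ≋ []
  0∷0≈0 = pointwise λ { zero → refl ; (suc i) → refl }

  +-congᵖ : ∀ {u u′ v v′} → u ≋ u′ → v ≋ v′ → u P.+ v ≋ u′ P.+ v′
  +-congᵖ {u} {u′} {v} {v′} p q = pointwise λ i →
    trans (coeff-+ u v i) (trans (+-cong (at p i) (at q i)) (sym (coeff-+ u′ v′ i)))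

  private
    +-assocᵖ : ∀ u v w → (u P.+ v) P.+ w ≋ u P.+ (v P.+ w)
    +-assocᵖ []      v       w       = ≈.refl
    +-assocᵖ (a ∷ u) []      w       = ≈.refl
    +-assocᵖ (a ∷ u) (b ∷ v) []      = ≈.refl
    +-assocᵖ (a ∷ u) (b ∷ v) (c ∷ w) = ∷-cong (+-assoc a b c) (+-assocᵖ u v w)

    +-commᵖ : ∀ u v → u P.+ v ≋ v P.+ u
    +-commᵖ u v = pointwise λ i → trans (coeff-+ u v i) (trans (+-comm _ _) (sym (coeff-+ v u i)))

    +-identityʳᵖ : ∀ u → u P.+ [] ≋ u
    +-identityʳᵖ []      = ≈.refl
    +-identityʳᵖ (a ∷ u) = ≈.refl

    -‿congᵖ : ∀ {u v} → u ≋ v → P.- u ≋ P.- v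
    -‿congᵖ {u} {v} p = pointwise λ i →
      trans (coeff-neg u i) (trans (-‿cong (at p i)) (sym (coeff-neg v i)))

    -‿inverseʳᵖ : ∀ u → u P.+ (P.- u) ≋ []
    -‿inverseʳᵖ u = pointwise λ i →
      trans (coeff-+ u (P.- u) i) (trans (+-congˡ (coeff-neg u i)) (-‿inverseʳ _))

    interchange : ∀ s t u v → (s P.+ t) P.+ (u P.+ v) ≋ (s P.+ u) P.+ (t P.+ v)
    interchange s t u v = pointwise λ i → begin
      coeff ((s P.+ t) P.+ (u P.+ v)) i
        ≈⟨ trans (coeff-+ (s P.+ t) _ i) (+-cong (coeff-+ s t i) (coeff-+ u v i)) ⟩
      (coeff s i + coeff t i) + (coeff u i + coeff v i)
        ≈⟨ solve 4 (λ s t u v → ((s :+ t) :+ (u :+ v)) := ((s :+ u) :+ (t :+ v))) refl _ _ _ _ ⟩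
      (coeff s i + coeff u i) + (coeff t i + coeff v i)
        ≈⟨ trans (coeff-+ (s P.+ u) _ i) (+-cong (coeff-+ s u i) (coeff-+ t v i)) ⟨
      coeff ((s P.+ u) P.+ (t P.+ v)) i ∎
      where open SetoidReasoning setoid

    scale-cong : ∀ a {u v} → u ≋ v → scale a u ≋ scale a v
    scale-cong a {u} {v} p = pointwise λ i →
      trans (coeff-scale a u i) (trans (*-congˡ (at p i)) (sym (coeff-scale a v i)))

    scale-+ : ∀ a u v → scale a (u P.+ v) ≋ scale a u P.+ scale a v
    scale-+ a []      v       = ≈.refl
    scale-+ a (b ∷ u) []      = ≈.refl
    scale-+ a (b ∷ u) (c ∷ v) = ∷-cong (distribˡ a b c) (scale-+ a u v)

    +-scale : ∀ a b u → scale (a + b) u ≋ scale a u P.+ scale b u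
    +-scale a b []      = ≈.refl
    +-scale a b (c ∷ u) = ∷-cong (distribʳ c a b) (+-scale a b u)

    scale-scale : ∀ a b u → scale (a * b) u ≋ scale a (scale b u)
    scale-scale a b []      = ≈.refl
    scale-scale a b (c ∷ u) = ∷-cong (*-assoc a b c) (scale-scale a b u)

    scale-0 : ∀ u → scale 0# u ≋ []
    scale-0 u = pointwise λ i → trans (coeff-scale 0# u i) (zeroˡ _)

    scale-1 : ∀ u → scale 1# u ≋ u
    scale-1 u = pointwise λ i → trans (coeff-scale 1# u i) (*-identityˡ _)

    open SetoidReasoning ≈-setoid

    -- Multiplication recurses on its left factor; this expansion along the right factor turns
    -- commutativity into an induction.
    *-∷ʳ : ∀ u b v → u P.* (b ∷ v) ≋ scale b u P.+ (0# ∷ u P.* v)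
    *-∷ʳ []      b v = ≈.sym 0∷0≈0
    *-∷ʳ (a ∷ u) b v = ∷-cong (+-congʳ (*-comm a b)) (begin
      scale a v P.+ u P.* (b ∷ v)                   ≈⟨ +-congᵖ ≈.refl (*-∷ʳ u b v) ⟩
      scale a v P.+ (scale b u P.+ (0# ∷ u P.* v))  ≈⟨ +-assocᵖ (scale a v) _ _ ⟨
      (scale a v P.+ scale b u) P.+ (0# ∷ u P.* v)  ≈⟨ +-congᵖ (+-commᵖ (scale a v) _) ≈.refl ⟩
      (scale b u P.+ scale a v) P.+ (0# ∷ u P.* v)  ≈⟨ +-assocᵖ (scale b u) _ _ ⟩
      scale b u P.+ (scale a v P.+ (0# ∷ u P.* v))  ∎)

    *-zeroʳᵖ : ∀ u → u P.* [] ≋ []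
    *-zeroʳᵖ []      = ≈.refl
    *-zeroʳᵖ (a ∷ u) = ≈.trans (∷-cong refl (*-zeroʳᵖ u)) 0∷0≈0

    *-commᵖ : ∀ u v → u P.* v ≋ v P.* u
    *-commᵖ []      v = ≈.sym (*-zeroʳᵖ v)
    *-commᵖ (a ∷ u) v = begin
      scale a v P.+ (0# ∷ u P.* v)  ≈⟨ +-congᵖ (≈.refl {scale a v}) (∷-cong refl (*-commᵖ u v)) ⟩
      scale a v P.+ (0# ∷ v P.* u)  ≈⟨ *-∷ʳ v a u ⟨
      v P.* (a ∷ u)                 ∎

    *-congˡᵖ : ∀ u {v w} → v ≋ w → u P.* v ≋ u P.* w
    *-congˡᵖ []      p = ≈.refl
    *-congˡᵖ (a ∷ u) p = +-congᵖ (scale-cong a p) (∷-cong refl (*-congˡᵖ u p))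

    *-congᵖ : ∀ {u u′ v v′} → u ≋ u′ → v ≋ v′ → u P.* v ≋ u′ P.* v′
    *-congᵖ {u} {u′} {v} {v′} p q = begin
      u P.* v    ≈⟨ *-congˡᵖ u q ⟩
      u P.* v′   ≈⟨ *-commᵖ u v′ ⟩
      v′ P.* u   ≈⟨ *-congˡᵖ v′ p ⟩
      v′ P.* u′  ≈⟨ *-commᵖ v′ u′ ⟩
      u′ P.* v′  ∎

    *-distribʳᵖ : ∀ w u v → (u P.+ v) P.* w ≋ u P.* w P.+ v P.* w
    *-distribʳᵖ w []      v       = ≈.refl
    *-distribʳᵖ w (a ∷ u) []      = ≈.sym (+-identityʳᵖ _)
    *-distribʳᵖ w (a ∷ u) (b ∷ v) = begin
      scale (a + b) w P.+ (0# ∷ (u P.+ v) P.* w)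
        ≈⟨ +-congᵖ (+-scale a b w) (∷-cong (sym (+-identityˡ 0#)) (*-distribʳᵖ w u v)) ⟩
      (scale a w P.+ scale b w) P.+ ((0# ∷ u P.* w) P.+ (0# ∷ v P.* w))
        ≈⟨ interchange (scale a w) _ _ _ ⟩
      (scale a w P.+ (0# ∷ u P.* w)) P.+ (scale b w P.+ (0# ∷ v P.* w)) ∎

    scale-* : ∀ a u v → scale a u P.* v ≋ scale a (u P.* v)
    scale-* a []      v = ≈.refl
    scale-* a (b ∷ u) v = begin
      scale (a * b) v P.+ (0# ∷ scale a u P.* v)
        ≈⟨ +-congᵖ (scale-scale a b v) (∷-cong (sym (zeroʳ a)) (scale-* a u v)) ⟩
      scale a (scale b v) P.+ scale a (0# ∷ u P.* v)
        ≈⟨ scale-+ a (scale b v) _ ⟨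
      scale a (scale b v P.+ (0# ∷ u P.* v)) ∎

    0∷-* : ∀ u v → (0# ∷ u) P.* v ≋ (0# ∷ u P.* v)
    0∷-* u v = +-congᵖ (scale-0 v) ≈.refl

    *-assocᵖ : ∀ u v w → (u P.* v) P.* w ≋ u P.* (v P.* w)
    *-assocᵖ []      v w = ≈.refl
    *-assocᵖ (a ∷ u) v w = begin
      (scale a v P.+ (0# ∷ u P.* v)) P.* w         ≈⟨ *-distribʳᵖ w (scale a v) _ ⟩
      scale a v P.* w P.+ (0# ∷ u P.* v) P.* w     ≈⟨ +-congᵖ (scale-* a v w) (0∷-* (u P.* v) w) ⟩
      scale a (v P.* w) P.+ (0# ∷ u P.* v P.* w)   ≈⟨ +-congᵖ (≈.refl {scale a (v P.* w)}) (∷-cong refl (*-assocᵖ u v w)) ⟩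
      scale a (v P.* w) P.+ (0# ∷ u P.* (v P.* w)) ∎

    *-identityˡᵖ : ∀ u → P.1# P.* u ≋ u
    *-identityˡᵖ u =
      ≈.trans (+-congᵖ (scale-1 u) 0∷0≈0) (+-identityʳᵖ u)

  polynomialRing : CommutativeRing c ℓ
  polynomialRing = record
    { Carrier = Poly ; _≈_ = _≋_ ; _+_ = P._+_ ; _*_ = P._*_ ; -_ = P.-_ ; 0# = [] ; 1# = P.1#
    ; isCommutativeRing = record
      { isRing = record
        { +-isAbelianGroup = record
          { isGroup = record
            { isMonoid = record
              { isSemigroup = record
                { isMagma = record { isEquivalence = ≈.isEquivalence ; ∙-cong = +-congᵖ }
                ; assoc = +-assocᵖ }
              ; identity = (λ u → ≈.refl) , +-identityʳᵖ }
            ; inverse = (λ u → ≈.trans (+-commᵖ (P.- u) u) (-‿inverseʳᵖ u)) , -‿inverseʳᵖ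
            ; ⁻¹-cong = -‿congᵖ }
          ; comm = +-commᵖ }
        ; *-cong = *-congᵖ
        ; *-assoc = *-assocᵖ
        ; *-identity = *-identityˡᵖ , λ u → ≈.trans (*-commᵖ u P.1#) (*-identityˡᵖ u)
        ; distrib = (λ w u v → ≈.trans (*-commᵖ w (u P.+ v))
                      (≈.trans (*-distribʳᵖ w u v) (+-congᵖ (*-commᵖ u w) (*-commᵖ v w))))
                  , *-distribʳᵖ }
      ; *-comm = *-commᵖ } }

  C-* : ∀ a u → P.C a P.* u ≋ scale a u
  C-* a u = ≈.trans (+-congᵖ {scale a u} ≈.refl 0∷0≈0) (+-identityʳᵖ _)

  X-* : ∀ u → P.X P.* u ≋ (0# ∷ u)
  X-* u = ≈.trans (0∷-* P.1# u) (∷-cong refl (*-identityˡᵖ u))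

module Evaluation {c ℓ} (R : CommutativeRing c ℓ) where

  open CommutativeRing R hiding (zero)
  open RingProperties ring using (-0#≈0#; -‿distribʳ-*; -‿+-comm)
  open SemiringSum semiring using (sum)
  open Exp semiring using (_^_)
  open SemiringSolver commutativeSemiring using (solve; _:=_; _:+_; _:*_)
  open SetoidReasoning setoid
  open PolynomialRing R
  private module P = Polynomial rawRing
  open P using (Poly; eval)

  -- The zero polynomial may be a nonempty list of zeros, so equal polynomials can differ in length.
  -- This lemma disposes of the surplus coefficients in `eval-cong`.
  eval-0 : ∀ u x → u ≋ [] → eval u x ≈ 0#
  eval-0 []      x u≋0 = refl
  eval-0 (a ∷ u) x u≋0 = begin
    a + x * eval u x  ≈⟨ +-cong (at u≋0 0) (*-congˡ (eval-0 u x (pointwise λ i → at u≋0 (suc i)))) ⟩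
    0# + x * 0#       ≈⟨ trans (+-identityˡ _) (zeroʳ x) ⟩
    0#                ∎

  eval-cong : ∀ u v {x y} → u ≋ v → x ≈ y → eval u x ≈ eval v y
  eval-cong []      v       u≋v x≈y = sym (eval-0 v _ (pointwise λ i → sym (at u≋v i)))
  eval-cong (a ∷ u) []      u≋v x≈y = eval-0 (a ∷ u) _ u≋v
  eval-cong (a ∷ u) (b ∷ v) u≋v x≈y =
    +-cong (at u≋v 0) (*-cong x≈y (eval-cong u v (pointwise λ i → at u≋v (suc i)) x≈y))

  eval-congʳ : ∀ u {x y} → x ≈ y → eval u x ≈ eval u y
  eval-congʳ u = eval-cong u u (pointwise λ i → refl)

  eval-+ : ∀ u v x → eval (u P.+ v) x ≈ eval u x + eval v x
  eval-+ []      v       x = sym (+-identityˡ _)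
  eval-+ (a ∷ u) []      x = sym (+-identityʳ _)
  eval-+ (a ∷ u) (b ∷ v) x = trans (+-congˡ (*-congˡ (eval-+ u v x)))
    (solve 5 (λ a b x u v → ((a :+ b) :+ x :* (u :+ v)) := ((a :+ x :* u) :+ (b :+ x :* v))) refl a b x _ _)

  eval-neg : ∀ u x → eval (P.- u) x ≈ - eval u x
  eval-neg []      x = sym -0#≈0#
  eval-neg (a ∷ u) x = begin
    - a + x * eval (P.- u) x   ≈⟨ +-congˡ (*-congˡ (eval-neg u x)) ⟩
    - a + x * - eval u x       ≈⟨ +-congˡ (-‿distribʳ-* x _) ⟨
    - a + - (x * eval u x)     ≈⟨ -‿+-comm a _ ⟩
    - (a + x * eval u x)       ∎

  eval-scale : ∀ a u x → eval (scale a u) x ≈ a * eval u x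
  eval-scale a []      x = sym (zeroʳ a)
  eval-scale a (b ∷ u) x = trans (+-congˡ (*-congˡ (eval-scale a u x)))
    (solve 4 (λ a b x u → (a :* b :+ x :* (a :* u)) := (a :* (b :+ x :* u))) refl a b x _)

  eval-* : ∀ u v x → eval (u P.* v) x ≈ eval u x * eval v x
  eval-* []      v x = sym (zeroˡ _)
  eval-* (a ∷ u) v x = begin
    eval (scale a v P.+ (0# ∷ u P.* v)) x
      ≈⟨ eval-+ (scale a v) _ x ⟩
    eval (scale a v) x + (0# + x * eval (u P.* v) x)
      ≈⟨ +-cong (eval-scale a v x) (trans (+-identityˡ _) (*-congˡ (eval-* u v x))) ⟩
    a * eval v x + x * (eval u x * eval v x)
      ≈⟨ solve 4 (λ a x u v → (a :* v :+ x :* (u :* v)) := ((a :+ x :* u) :* v)) refl a x _ _ ⟩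
    (a + x * eval u x) * eval v x                    ∎

  eval-C : ∀ a x → eval (P.C a) x ≈ a
  eval-C a x = trans (+-congˡ (zeroʳ x)) (+-identityʳ a)

  eval-X : ∀ x → eval P.X x ≈ x
  eval-X x = trans (+-identityˡ _) (trans (*-congˡ (eval-C 1# x)) (*-identityʳ x))

  eval-^ : ∀ u n x → eval (u P.^ n) x ≈ eval u x ^ n
  eval-^ u zero    x = eval-C 1# x
  eval-^ u (suc n) x = trans (eval-* u (u P.^ n) x) (*-congˡ (eval-^ u n x))

  eval-sum : ∀ {n} (u : Fin n → Poly) x → eval (P.sum u) x ≈ sum (λ i → eval (u i) x)
  eval-sum {zero}  u x = refl
  eval-sum {suc n} u x = trans (eval-+ (u zero) (P.sum (u ⊙ suc)) x) (+-congˡ (eval-sum (u ⊙ suc) x))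

  eval-∘ : ∀ u v x → eval (u P.∘ v) x ≈ eval u (eval v x)
  eval-∘ []      v x = refl
  eval-∘ (a ∷ u) v x = trans (eval-+ (P.C a) (v P.* (u P.∘ v)) x)
    (+-cong (eval-C a x) (trans (eval-* v (u P.∘ v) x) (*-congˡ (eval-∘ u v x))))

module Coefficients {c ℓ} (R : CommutativeRing c ℓ) where

  open CommutativeRing R hiding (zero)
  open PolynomialRing R
  private module P = Polynomial rawRing
  open P using (Poly; coeff)

  coeff-X^-same : ∀ m → coeff (P.X P.^ m) m ≈ 1#
  coeff-X^-same zero    = refl
  coeff-X^-same (suc m) = trans (at (X-* (P.X P.^ m)) (suc m)) (coeff-X^-same m)

  coeff-X^-other : ∀ m {i} → i ≢ m → coeff (P.X P.^ m) i ≈ 0#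
  coeff-X^-other zero    {zero}  i≢m = contradiction ≡.refl i≢m
  coeff-X^-other zero    {suc i} i≢m = refl
  coeff-X^-other (suc m) {zero}  i≢m = at (X-* (P.X P.^ m)) zero
  coeff-X^-other (suc m) {suc i} i≢m =
    trans (at (X-* (P.X P.^ m)) (suc i)) (coeff-X^-other m (i≢m ⊙ ≡.cong suc))

  coeff-C* : ∀ a u i → coeff (P.C a P.* u) i ≈ a * coeff u i
  coeff-C* a u i = trans (at (C-* a u) i) (coeff-scale a u i)

  -- With exponents `q ^ k` this is `linearized q`. The exponent function is a parameter because
  -- passing to the tail of u replaces e by `e ⊙ suc`.
  sparse : (ℕ → ℕ) → Poly → Poly
  sparse e u = P.sum {length u} λ k → P.C (lookup u k) P.* P.X P.^ e (toℕ k)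

  -- The alternative `coeff u k ≈ 0#` admits trailing zeros of u: their exponents may equal j
  -- without contributing.
  coeff-sparse-other : ∀ e u j → (∀ k → coeff u k ≈ 0# ⊎ j ≢ e k) → coeff (sparse e u) j ≈ 0#
  coeff-sparse-other e []      j absent = refl
  coeff-sparse-other e (a ∷ u) j absent = begin
    coeff (sparse e (a ∷ u)) j
      ≈⟨ coeff-+ (P.C a P.* P.X P.^ e 0) _ j ⟩
    coeff (P.C a P.* P.X P.^ e 0) j + coeff (sparse (e ⊙ suc) u) j
      ≈⟨ +-cong (trans (coeff-C* a (P.X P.^ e 0) j) (head-absent (absent 0)))
                (coeff-sparse-other (e ⊙ suc) u j (absent ⊙ suc)) ⟩
    0# + 0#
      ≈⟨ +-identityˡ 0# ⟩
    0# ∎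
    where
    open SetoidReasoning setoid
    head-absent : a ≈ 0# ⊎ j ≢ e 0 → a * coeff (P.X P.^ e 0) j ≈ 0#
    head-absent (inj₁ a≈0)  = trans (*-congʳ a≈0) (zeroˡ _)
    head-absent (inj₂ j≢e0) = trans (*-congˡ (coeff-X^-other (e 0) j≢e0)) (zeroʳ a)

  -- Injectivity of e keeps two terms from merging into the same coefficient.
  coeff-sparse : ∀ e → (∀ {i j} → e i ≡ e j → i ≡ j) → ∀ u i → coeff (sparse e u) (e i) ≈ coeff u i
  coeff-sparse e e-inj []      i       = refl
  coeff-sparse e e-inj (a ∷ u) zero    = begin
    coeff (sparse e (a ∷ u)) (e 0)
      ≈⟨ coeff-+ (P.C a P.* P.X P.^ e 0) _ (e 0) ⟩
    coeff (P.C a P.* P.X P.^ e 0) (e 0) + coeff (sparse (e ⊙ suc) u) (e 0)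
      ≈⟨ +-cong (trans (coeff-C* a (P.X P.^ e 0) (e 0)) (*-congˡ (coeff-X^-same (e 0))))
                (coeff-sparse-other (e ⊙ suc) u (e 0) λ k → inj₂ λ eq → ℕ.0≢1+n (e-inj eq)) ⟩
    a * 1# + 0#
      ≈⟨ trans (+-identityʳ _) (*-identityʳ a) ⟩
    a ∎
    where open SetoidReasoning setoid
  coeff-sparse e e-inj (a ∷ u) (suc i) = begin
    coeff (sparse e (a ∷ u)) (e (suc i))
      ≈⟨ coeff-+ (P.C a P.* P.X P.^ e 0) _ (e (suc i)) ⟩
    coeff (P.C a P.* P.X P.^ e 0) (e (suc i)) + coeff (sparse (e ⊙ suc) u) (e (suc i))
      ≈⟨ +-cong (trans (coeff-C* a (P.X P.^ e 0) (e (suc i))) (*-congˡ (coeff-X^-other (e 0) λ eq → ℕ.1+n≢0 (e-inj eq))))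
                (coeff-sparse (e ⊙ suc) (ℕ.suc-injective ⊙ e-inj) u i) ⟩
    a * 0# + coeff u i
      ≈⟨ trans (+-congʳ (zeroʳ a)) (+-identityˡ _) ⟩
    coeff u i ∎
    where open SetoidReasoning setoid

-- Division with remainder, cancellation and inverses modulo a polynomial.

module Division {c ℓ} (R : CommutativeRing c ℓ) where

  open CommutativeRing R hiding (zero)
  open RingProperties ring using (-0#≈0#)
  open SetoidReasoning setoid
  open PolynomialRing R
  open Coefficients R
  private
    module P  = Polynomial rawRing
    module PR = CommutativeRing polynomialRing
  open P using (Poly; coeff; DegreeBelow)

  -- An invertible leading coefficient is what division and cancellation require; with it they work
  -- over any commutative ring, and lists need not be normalized.
  record HasDegree (d : ℕ) (w : Poly) : Set (c ⊔ ℓ) where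
    field
      below       : DegreeBelow (suc d) w
      lead⁻¹      : Carrier
      lead⁻¹*lead : lead⁻¹ * coeff w d ≈ 1#

  -- If the tail of u is q w + r, then u = (X q) w + s with s = x + X r of degree at most d.
  -- Subtracting the multiple e of w that matches the coefficient of s at d brings the remainder
  -- below d.
  divMod : ∀ {d w} → HasDegree d w → ∀ u → ∃₂ λ q r → DegreeBelow d r × u ≋ q P.* w P.+ r
  divMod W []      = [] , [] , (λ i _ → refl) , PR.refl
  divMod {d} {w} W (x ∷ u) with q , r , r-below , u≋ ← divMod W u =
    e ∷ q , s P.+ P.- scale e w , remainder-below ,
    PR.trans (∷-cong (sym (+-identityˡ x)) u≋) (PR.sym (cancel (scale e w) (0# ∷ q P.* w) s))
    where
    open HasDegree W
    s = x ∷ r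
    e = coeff s d * lead⁻¹

    e*lead≈ : e * coeff w d ≈ coeff s d
    e*lead≈ = trans (*-assoc _ _ _) (trans (*-congˡ lead⁻¹*lead) (*-identityʳ _))

    s-below : ∀ i → suc d ℕ.≤ i → coeff s i ≈ 0#
    s-below (suc i) (s≤s d≤i) = r-below i d≤i

    remainder-coeff : ∀ i → coeff (s P.+ P.- scale e w) i ≈ coeff s i - e * coeff w i
    remainder-coeff i = trans (coeff-+ s (P.- scale e w) i)
      (+-congˡ (trans (coeff-neg (scale e w) i) (-‿cong (coeff-scale e w i))))

    remainder-below : DegreeBelow d (s P.+ P.- scale e w)
    remainder-below i d≤i = case ℕ.m≤n⇒m<n∨m≡n d≤i of λ where
      (inj₁ d<i) → begin
        coeff (s P.+ P.- scale e w) i  ≈⟨ remainder-coeff i ⟩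
        coeff s i - e * coeff w i      ≈⟨ +-cong (s-below i d<i) (-‿cong (trans (*-congˡ (below i d<i)) (zeroʳ e))) ⟩
        0# - 0#                        ≈⟨ -‿inverseʳ 0# ⟩
        0#                             ∎
      (inj₂ ≡.refl) → begin
        coeff (s P.+ P.- scale e w) d  ≈⟨ remainder-coeff d ⟩
        coeff s d - e * coeff w d      ≈⟨ +-congˡ (-‿cong e*lead≈) ⟩
        coeff s d - coeff s d          ≈⟨ -‿inverseʳ _ ⟩
        0#                             ∎

    cancel : ∀ A B S → (A P.+ B) P.+ (S P.+ P.- A) ≋ B P.+ S
    cancel A B S = PR.trans (PR.+-cong (PR.+-comm A B) (PR.+-comm S _))
      (PR.trans (PR.+-assoc B A _) (PR.+-congˡ (PR.trans (PR.sym (PR.+-assoc A _ S))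
        (PR.trans (PR.+-congʳ (PR.-‿inverseʳ A)) (PR.+-identityˡ S)))))

  -- Beyond degree d the summand x w contributes nothing, so the tail of the factor satisfies the
  -- same bound and vanishes by induction. What remains is x w, whose coefficient at d is x times a
  -- unit.
  *-below⇒0 : ∀ {d w} → HasDegree d w → ∀ q → DegreeBelow d (q P.* w) → q ≋ []
  *-below⇒0 W []      below = PR.refl
  *-below⇒0 {d} {w} W (x ∷ q) qw-below = PR.trans (∷-cong x≈0 q≋0) 0∷0≈0
    where
    open HasDegree W

    q-below : DegreeBelow d (q P.* w)
    q-below i d≤i = begin
      coeff (q P.* w) i                           ≈⟨ +-identityˡ _ ⟨
      0# + coeff (q P.* w) i                      ≈⟨ +-congʳ (trans (*-congˡ (below (suc i) (s≤s d≤i))) (zeroʳ x)) ⟨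
      x * coeff w (suc i) + coeff (q P.* w) i     ≈⟨ +-congʳ (coeff-scale x w (suc i)) ⟨
      coeff (scale x w) (suc i) + coeff (q P.* w) i ≈⟨ coeff-+ (scale x w) _ (suc i) ⟨
      coeff ((x ∷ q) P.* w) (suc i)               ≈⟨ qw-below (suc i) (ℕ.m≤n⇒m≤1+n d≤i) ⟩
      0#                                          ∎

    q≋0 : q ≋ []
    q≋0 = *-below⇒0 W q q-below

    x*lead≈0 : x * coeff w d ≈ 0#
    x*lead≈0 = begin
      x * coeff w d                                    ≈⟨ coeff-scale x w d ⟨
      coeff (scale x w) d                              ≈⟨ +-identityʳ _ ⟨
      coeff (scale x w) d + 0#                         ≈⟨ +-congˡ (at (PR.trans (∷-cong refl (PR.*-congʳ {w} q≋0)) 0∷0≈0) d) ⟨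
      coeff (scale x w) d + coeff (0# ∷ q P.* w) d     ≈⟨ coeff-+ (scale x w) _ d ⟨
      coeff ((x ∷ q) P.* w) d                          ≈⟨ qw-below d ℕ.≤-refl ⟩
      0#                                               ∎

    x≈0 : x ≈ 0#
    x≈0 = begin
      x                          ≈⟨ *-identityʳ x ⟨
      x * 1#                     ≈⟨ *-congˡ (trans (*-comm _ _) lead⁻¹*lead) ⟨
      x * (coeff w d * lead⁻¹)   ≈⟨ *-assoc x _ _ ⟨
      x * coeff w d * lead⁻¹     ≈⟨ *-congʳ x*lead≈0 ⟩
      0# * lead⁻¹                ≈⟨ zeroˡ _ ⟩
      0#                         ∎

  -- Substituting one equation into the other gives s v m = m, and m can be cancelled because its
  -- leading coefficient is invertible.
  cofactor-unit : ∀ {d m} → HasDegree d m → ∀ {s v w} → w P.* v ≋ m → w ≋ s P.* m → s P.* v ≋ P.1#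
  cofactor-unit {m = m} M {s} {v} {w} wv≋m w≋sm =
    x∙y⁻¹≈ε⇒x≈y (s P.* v) P.1# (*-below⇒0 M (s P.* v P.- P.1#) λ i _ → at [sv-1]m≋0 i)
    where
    open RingProperties PR.ring using (x∙y⁻¹≈ε⇒x≈y; x≈y⇒x∙y⁻¹≈ε; [y-z]x≈yx-zx)
    open SemiringSolver PR.commutativeSemiring using (solve; _:=_; _:*_)

    svm≋m : s P.* v P.* m ≋ m
    svm≋m = PR.trans (solve 3 (λ s v m → (s :* v :* m) := (s :* m :* v)) PR.refl s v m)
      (PR.trans (PR.*-congʳ {v} (PR.sym w≋sm)) wv≋m)

    [sv-1]m≋0 : (s P.* v P.- P.1#) P.* m ≋ []
    [sv-1]m≋0 = PR.trans ([y-z]x≈yx-zx m (s P.* v) P.1#)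
      (x≈y⇒x∙y⁻¹≈ε (PR.trans svm≋m (PR.sym (PR.*-identityˡ m))))

  mod-elim : ∀ {u v w} → u P.≡ v [mod w ] → ∃ λ e → u ≋ v P.+ e P.* w
  mod-elim {u} {v} {w} (e , ew≈u-v) = e , PR.trans (PR.sym (PR.+-identityʳ u))
    (PR.trans (PR.+-congˡ {u} (PR.sym (PR.-‿inverseˡ v)))
    (PR.trans (PR.sym (PR.+-assoc u (P.- v) v))
    (PR.trans (PR.+-congʳ {v} (PR.sym (pointwise {e P.* w} {u P.- v} ew≈u-v))) (PR.+-comm (e P.* w) v))))

  mod-intro : ∀ {u v w} e → u ≋ v P.+ e P.* w → u P.≡ v [mod w ]
  mod-intro {u} {v} {w} e u≋ = e , at (PR.sym (PR.trans (PR.+-congʳ {P.- v} (PR.trans u≋ (PR.+-comm v (e P.* w))))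
    (PR.trans (PR.+-assoc (e P.* w) v (P.- v)) (PR.trans (PR.+-congˡ {e P.* w} (PR.-‿inverseʳ v)) (PR.+-identityʳ _)))))

  module _ {d w h s t} (W : HasDegree d w) (bézout : s P.* h P.+ t P.* w ≋ P.1#) where

    private
      open SemiringSolver PR.commutativeSemiring using (solve; _:=_; _:+_; _:*_)

      -- Multiplying the Bézout identity by H gives H = s (h H) + t H w, and h H = 1 + e w: every
      -- inverse of h modulo w is congruent to s.
      inverse≋ : ∀ {H} → (h P.* H) P.≡ P.1# [mod w ] → ∃ λ e → H ≋ s P.+ e P.* w
      inverse≋ {H} hH≡1 with e , hH≋ ← mod-elim hH≡1 = s P.* e P.+ t P.* H , PR.trans (PR.sym (PR.*-identityˡ H))
        (PR.trans (PR.*-congʳ {H} (PR.sym bézout))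
        (PR.trans (solve 5 (λ s h t w H → ((s :* h :+ t :* w) :* H) := (s :* (h :* H) :+ t :* H :* w)) PR.refl s h t w H)
        (PR.trans (PR.+-congʳ (PR.trans (PR.*-congˡ {s} hH≋) (PR.trans (PR.distribˡ s P.1# _) (PR.+-congʳ (PR.*-identityʳ s)))))
        (solve 5 (λ s e w t H → (s :+ s :* (e :* w) :+ t :* H :* w) := (s :+ (s :* e :+ t :* H) :* w)) PR.refl s e w t H))))

    modular-inverse : ∃! P._≈_ λ H → DegreeBelow d H × (h P.* H) P.≡ P.1# [mod w ]
    modular-inverse with q , H , H-below , s≋ ← divMod W s =
      H , (H-below , hH≡1) , λ (H′-below , hH′≡1) → at (unique H-below hH≡1 H′-below hH′≡1)
      where
      hH≡1 : (h P.* H) P.≡ P.1# [mod w ]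
      -- From H = s - q w and the Bézout identity, h H = 1 - (h q + t) w.
      hH≡1 = mod-intro (P.- (h P.* q P.+ t)) (PR.trans (PR.sym (PR.+-identityʳ _))
        (PR.trans (PR.+-congˡ {h P.* H} (PR.sym (PR.trans (PR.*-congʳ {w} (PR.-‿inverseʳ (h P.* q P.+ t))) PR.refl)))
        (PR.trans (solve 6 (λ h H q t m w → (h :* H :+ (h :* q :+ t :+ m) :* w) := ((q :* w :+ H) :* h :+ t :* w :+ m :* w))
                    PR.refl h H q t (P.- (h P.* q P.+ t)) w)
        (PR.+-congʳ (PR.trans (PR.+-congʳ (PR.*-congʳ {h} (PR.sym s≋))) bézout)))))

      unique : ∀ {H H′} → DegreeBelow d H → (h P.* H) P.≡ P.1# [mod w ] →
        DegreeBelow d H′ → (h P.* H′) P.≡ P.1# [mod w ] → H ≋ H′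
      unique {H} {H′} H-below hH≡1 H′-below hH′≡1 =
        x∙y⁻¹≈ε⇒x≈y H H′ (PR.trans H-H′≋ (PR.trans (PR.*-congʳ {w} E≋0) PR.refl))
        where
        open RingProperties PR.ring using (x∙y⁻¹≈ε⇒x≈y; [y-z]x≈yx-zx; -‿anti-homo-+)
        e  = proj₁ (inverse≋ hH≡1)
        e′ = proj₁ (inverse≋ hH′≡1)

        cancel : ∀ s A B → (s P.+ A) P.- (s P.+ B) ≋ A P.- B
        cancel s A B = PR.trans (PR.+-cong (PR.+-comm s A) (-‿anti-homo-+ s B))
          (PR.trans (solve 4 (λ s A B′ s′ → (A :+ s :+ (B′ :+ s′)) := (A :+ B′ :+ (s :+ s′))) PR.refl s A (P.- B) (P.- s))
          (PR.trans (PR.+-congˡ {A P.- B} (PR.-‿inverseʳ s)) (PR.+-identityʳ _)))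

        H-H′≋ : H P.- H′ ≋ (e P.- e′) P.* w
        H-H′≋ = PR.trans (PR.+-cong (proj₂ (inverse≋ hH≡1)) (PR.-‿cong (proj₂ (inverse≋ hH′≡1))))
          (PR.trans (cancel s (e P.* w) (e′ P.* w)) (PR.sym ([y-z]x≈yx-zx w e e′)))

        E≋0 : e P.- e′ ≋ []
        E≋0 = *-below⇒0 W (e P.- e′) λ i d≤i → trans (sym (at H-H′≋ i)) (trans (coeff-+ H _ i)
          (trans (+-cong (H-below i d≤i) (trans (coeff-neg H′ i) (trans (-‿cong (H′-below i d≤i)) -0#≈0#))) (+-identityˡ 0#)))

-- The number of roots of a polynomial over a domain.

module RootCounting {c ℓ} (R : CommutativeRing c ℓ) where

  open CommutativeRing R hiding (zero)
  open RingProperties ring using (x≈y⇒x∙y⁻¹≈ε; x∙y⁻¹≈ε⇒x≈y; [y-z]x≈yx-zx)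
  open SemiringSolver commutativeSemiring using (solve; _:=_; _:+_; _:*_)
  open SetoidReasoning setoid
  open PolynomialRing R
  open Evaluation R
  private module P = Polynomial rawRing
  open P using (Poly; coeff; eval; DegreeBelow)

  -- The quotient of u - u(z) by X - z.
  divideRoot : Carrier → Poly → Poly
  divideRoot z []      = []
  divideRoot z (a ∷ u) = eval u z ∷ divideRoot z u

  -- The identity u(x) - u(z) = (x - z) v(x) for the quotient v, rearranged without subtraction so
  -- that the semiring solver applies.
  eval-divideRoot : ∀ z u x →
    eval u x + z * eval (divideRoot z u) x ≈ x * eval (divideRoot z u) x + eval u z
  eval-divideRoot z []      x = solve 2 (λ x z → (con 0 :+ z :* con 0) := (x :* con 0 :+ con 0)) refl x z
    where open SemiringSolver commutativeSemiring using (con)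
  eval-divideRoot z (a ∷ u) x = begin
    (a + x * ux) + z * (uz + x * dx)
      ≈⟨ solve 6 (λ a x z ux uz dx → ((a :+ x :* ux) :+ z :* (uz :+ x :* dx)) :=
                                     ((a :+ z :* uz) :+ x :* (ux :+ z :* dx))) refl a x z ux uz dx ⟩
    (a + z * uz) + x * (ux + z * dx)
      ≈⟨ +-congˡ (*-congˡ (eval-divideRoot z u x)) ⟩
    (a + z * uz) + x * (x * dx + uz)
      ≈⟨ solve 5 (λ a x z uz dx → ((a :+ z :* uz) :+ x :* (x :* dx :+ uz)) :=
                                  (x :* (uz :+ x :* dx) :+ (a :+ z :* uz))) refl a x z uz dx ⟩
    x * (uz + x * dx) + (a + z * uz) ∎
    where
    ux = eval u x
    uz = eval u z
    dx = eval (divideRoot z u) x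

  -- Horner's recurrence. Together with `coeff-divideRoot-suc` it recovers u from its quotient and
  -- u(z), so that u = 0 once both vanish; `roots⇒0` ends in this way.
  coeff-divideRoot-zero : ∀ z u → coeff u 0 + z * coeff (divideRoot z u) 0 ≈ eval u z
  coeff-divideRoot-zero z []      = trans (+-identityˡ _) (zeroʳ z)
  coeff-divideRoot-zero z (a ∷ u) = refl

  coeff-divideRoot-suc : ∀ z u i →
    coeff u (suc i) + z * coeff (divideRoot z u) (suc i) ≈ coeff (divideRoot z u) i
  coeff-divideRoot-suc z []      i       = trans (+-identityˡ _) (zeroʳ z)
  coeff-divideRoot-suc z (a ∷ u) zero    = coeff-divideRoot-zero z u
  coeff-divideRoot-suc z (a ∷ u) (suc i) = coeff-divideRoot-suc z u i

  divideRoot-below : ∀ z u d → DegreeBelow (suc d) u → DegreeBelow d (divideRoot z u)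
  divideRoot-below z []      d       u-below i       d≤i       = refl
  divideRoot-below z (a ∷ u) zero    u-below zero    d≤i       =
    eval-0 u z (pointwise λ i → u-below (suc i) (s≤s z≤n))
  divideRoot-below z (a ∷ u) d       u-below (suc i) d≤i       =
    divideRoot-below z u i (λ j 1+i≤j → u-below (suc j) (s≤s (ℕ.≤-trans d≤i 1+i≤j))) i ℕ.≤-refl

  module _ (integral : ∀ {x y} → x * y ≈ 0# → ¬ x ≈ 0# → y ≈ 0#) where

    -- In a domain every root of u other than z is a root of the quotient of u by X - z, which has
    -- one degree and one prescribed root less.
    roots⇒0 : ∀ d u → DegreeBelow d u → (x : Fin d → Carrier) →
      (∀ {i j} → x i ≈ x j → i ≡ j) → (∀ i → eval u (x i) ≈ 0#) → u ≋ []
    roots⇒0 zero    u u-below x x-inj roots = pointwise λ i → u-below i z≤n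
    roots⇒0 (suc d) u u-below x x-inj roots = pointwise λ where
        zero    → sum-zero (trans (coeff-divideRoot-zero z u) (roots zero)) (at v≋0 0)
        (suc i) → sum-zero (trans (coeff-divideRoot-suc z u i) (at v≋0 i)) (at v≋0 (suc i))
      where
      z = x zero
      v = divideRoot z u

      sum-zero : ∀ {a b} → a + z * b ≈ 0# → b ≈ 0# → a ≈ 0#
      sum-zero {a} {b} eq b≈0 = begin
        a           ≈⟨ +-identityʳ a ⟨
        a + 0#      ≈⟨ +-congˡ (trans (*-congˡ b≈0) (zeroʳ z)) ⟨
        a + z * b   ≈⟨ eq ⟩
        0#          ∎

      root : ∀ i → eval v (x (suc i)) ≈ 0#
      root i = integral (begin
        (y - z) * vy       ≈⟨ [y-z]x≈yx-zx vy y z ⟩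
        y * vy - z * vy    ≈⟨ x≈y⇒x∙y⁻¹≈ε y*vy≈z*vy ⟩
        0#                 ∎)
        (λ y-z≈0 → contradiction (x-inj (x∙y⁻¹≈ε⇒x≈y _ _ y-z≈0)) λ ())
        where
        y  = x (suc i)
        vy = eval v y
        y*vy≈z*vy : y * vy ≈ z * vy
        y*vy≈z*vy = begin
          y * vy             ≈⟨ +-identityʳ _ ⟨
          y * vy + 0#        ≈⟨ +-congˡ (roots zero) ⟨
          y * vy + eval u z  ≈⟨ eval-divideRoot z u y ⟨
          eval u y + z * vy  ≈⟨ +-congʳ (roots (suc i)) ⟩
          0# + z * vy        ≈⟨ +-identityˡ _ ⟩
          z * vy             ∎

      v≋0 : v ≋ []
      v≋0 = roots⇒0 d v (divideRoot-below z u d u-below) (x ⊙ suc)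
        (λ eq → Fin.suc-injective (x-inj eq)) root

-- The Euclidean algorithm.

module Euclid {c ℓ} (R : CommutativeRing c ℓ) where

  open CommutativeRing R hiding (zero)
  open PolynomialRing R
  open Division R
  private
    module P  = Polynomial rawRing
    module PR = CommutativeRing polynomialRing
  open P using (Poly; coeff; DegreeBelow)
  open SemiringSolver PR.commutativeSemiring using (solve; _:=_; _:+_; _:*_)

  record GCD (u v : Poly) : Set (c ⊔ ℓ) where
    field
      gcd s t u/gcd v/gcd : Poly
      gcd∣u  : u/gcd P.* gcd ≋ u
      gcd∣v  : v/gcd P.* gcd ≋ v
      bézout : s P.* u P.+ t P.* v ≋ gcd

  private
    -- The Bézout identity of the pair (v, r), with r = u - q v substituted.
    combine : ∀ q v r u s t d → u ≋ q P.* v P.+ r → s P.* v P.+ t P.* r ≋ d →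
      t P.* u P.+ (s P.+ t P.* (P.- q)) P.* v ≋ d
    combine q v r u s t d u≋ bézout = begin
      t P.* u P.+ (s P.+ t P.* (P.- q)) P.* v
        ≈⟨ PR.+-congʳ (PR.*-congˡ {t} u≋) ⟩
      t P.* (q P.* v P.+ r) P.+ (s P.+ t P.* (P.- q)) P.* v
        ≈⟨ solve 6 (λ q q⁻ v r s t → (t :* (q :* v :+ r) :+ (s :+ t :* q⁻) :* v) :=
                                    ((s :* v :+ t :* r) :+ (t :* (q :+ q⁻)) :* v)) PR.refl q (P.- q) v r s t ⟩
      (s P.* v P.+ t P.* r) P.+ (t P.* (q P.+ P.- q)) P.* v
        ≈⟨ PR.+-cong bézout (PR.trans (PR.*-congʳ {v} (PR.trans (PR.*-congˡ {t} (PR.-‿inverseʳ q)) (PR.zeroʳ t))) PR.refl) ⟩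
      d P.+ []
        ≈⟨ PR.+-identityʳ d ⟩
      d ∎
      where open SetoidReasoning PR.setoid

  module _ (≈0? : ∀ x → Dec (x ≈ 0#)) (inverse : ∀ {x} → ¬ x ≈ 0# → ∃ λ y → y * x ≈ 1#) where

    -- The recursion is on a degree bound d of v and not on an exact degree. If the top coefficient
    -- allowed by the bound is zero, the bound drops; if not, that coefficient is invertible, v can
    -- serve as a divisor, and the remainder obeys the smaller bound.
    computeGCD : ∀ d u v → DegreeBelow d v → GCD u v
    computeGCD zero    u v v-below = record
      { gcd = u ; s = P.1# ; t = [] ; u/gcd = P.1# ; v/gcd = []
      ; gcd∣u = PR.*-identityˡ u
      ; gcd∣v = pointwise λ i → sym (v-below i z≤n)
      ; bézout = PR.trans (PR.+-identityʳ (P.1# P.* u)) (PR.*-identityˡ u) }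
    computeGCD (suc d) u v v-below with ≈0? (coeff v d)
    ... | yes v_d≈0 = computeGCD d u v λ i d≤i → case ℕ.m≤n⇒m<n∨m≡n d≤i of λ where
      (inj₁ d<i)    → v-below i d<i
      (inj₂ ≡.refl) → v_d≈0
    ... | no v_d≉0
      with q , r , r-below , u≋ ← divMod (record { below = v-below ; lead⁻¹ = proj₁ (inverse v_d≉0)
                                                 ; lead⁻¹*lead = proj₂ (inverse v_d≉0) }) u
      = record
      { gcd = gcd ; s = t ; t = s P.+ t P.* (P.- q)
      ; u/gcd = q P.* u/gcd P.+ v/gcd ; v/gcd = u/gcd
      ; gcd∣u = PR.trans (solve 4 (λ q x y g → ((q :* x :+ y) :* g) := (q :* (x :* g) :+ y :* g)) PR.refl q u/gcd v/gcd gcd)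
                 (PR.trans (PR.+-cong (PR.*-congˡ {q} gcd∣u) gcd∣v) (PR.sym u≋))
      ; gcd∣v = gcd∣u
      ; bézout = combine q v r u s t gcd u≋ bézout }
      where
      open GCD (computeGCD d v r r-below)

    -- `Coprime` says that common divisors divide 1. The computed gcd is therefore a unit, and the
    -- inverse e of it rescales the Bézout identity.
    coprime⇒bézout : ∀ {d u v} → DegreeBelow d v → P.Coprime u v → ∃₂ λ s t → s P.* u P.+ t P.* v ≋ P.1#
    coprime⇒bézout {d} {u} {v} v-below coprime = finish (coprime (u/gcd , at gcd∣u) (v/gcd , at gcd∣v))
      where
      open GCD (computeGCD d u v v-below)
      finish : gcd P.∣ P.1# → ∃₂ λ s t → s P.* u P.+ t P.* v ≋ P.1#
      finish (e , e*gcd≈1) = e P.* s , e P.* t , PR.trans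
        (solve 5 (λ e s t u v → (e :* s :* u :+ e :* t :* v) := (e :* (s :* u :+ t :* v))) PR.refl e s t u v)
        (PR.trans (PR.*-congˡ {e} bézout) (pointwise e*gcd≈1))

-- Finite sets and finite fields.

-- Pigeonhole: if j were missed, punching it out would inject a set of n + 1 elements into one of n
-- elements.
Fin-injective⇒surjective : ∀ {n} (f : Fin n → Fin n) → Injective _≡_ _≡_ f → StrictlySurjective _≡_ f
Fin-injective⇒surjective {suc n} f f-inj j with Fin.any? (λ i → f i Fin.≟ j)
... | yes hit = hit
... | no miss = contradiction
  (Fin.injective⇒≤ {f = λ i → punchOut (j≢f i)} λ eq → f-inj (Fin.punchOut-injective (j≢f _) (j≢f _) eq))
  ℕ.1+n≰n
  where
  j≢f : ∀ i → j ≢ f i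
  j≢f i j≡fi = miss (i , ≡.sym j≡fi)

-- A choice g of preimages is injective, hence surjective by the previous lemma, so the right
-- inverse g of f is two-sided.
Fin-surjective⇒injective : ∀ {n} (f : Fin n → Fin n) → StrictlySurjective _≡_ f → Injective _≡_ _≡_ f
Fin-surjective⇒injective f f-surj {i} {j} fi≡fj =
  let i′ , g[i′]≡i = g-surj i
      j′ , g[j′]≡j = g-surj j
      i′≡j′ = ≡.trans (≡.sym (fg i′)) (≡.trans (≡.cong f g[i′]≡i)
                (≡.trans fi≡fj (≡.trans (≡.cong f (≡.sym g[j′]≡j)) (fg j′))))
  in ≡.trans (≡.sym g[i′]≡i) (≡.trans (≡.cong g i′≡j′) g[j′]≡j)
  where
  g  = proj₁ ⊙ f-surj
  fg = proj₂ ⊙ f-surj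
  g-surj = Fin-injective⇒surjective g
    (λ {x} {y} eq → ≡.trans (≡.sym (fg x)) (≡.trans (≡.cong f eq) (fg y)))

module FiniteFieldProperties {c ℓ₁ ℓ₂ N} (FF : FiniteField c ℓ₁ ℓ₂ N) where

  open FiniteField FF using (_#_; _≟_; _⁻¹; ⁻¹-inverseʳ; invertible?; enumeration; heytingField; commutativeRing)
  open HeytingField heytingField using (tight; invertible⇒#)
  open CommutativeRing commutativeRing hiding (zero)
  open RingProperties ring using (-0#≈0#; +-identityʳ-unique)
  open CommutativeExp commutativeSemiring using (_^_)
  open Mult semiring using (×1-homo-*) renaming (_×_ to _·_)
  open SemiringSum semiring using (sum; ∑-distrib-+; sum-replicate; sum-cong-≋)
  private
    module E = Inverse enumeration
    module Π = Sum *-commutativeMonoid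
  open SetoidReasoning setoid

  ⁻¹-inverseˡ : ∀ {x} → x # 0# → x ⁻¹ * x ≈ 1#
  ⁻¹-inverseˡ x#0 = trans (*-comm _ _) (⁻¹-inverseʳ x#0)

  #⇒≉ : ∀ {x} → x # 0# → ¬ x ≈ 0#
  #⇒≉ {x} x#0 x≈0 = proj₂ (tight x 0#) x≈0 x#0

  -- Inequality does not by itself give apartness. Here invertibility is decided by search, and an
  -- element without inverse cannot be apart from 0, so it equals 0 by tightness.
  ≉⇒# : ∀ {x} → ¬ x ≈ 0# → x # 0#
  ≉⇒# {x} x≉0 with invertible? x
  ... | yes (i , x*y≈1) = invertible⇒# (E.to i
    , trans (*-comm _ _) (trans (*-congʳ x-0≈x) x*y≈1) , trans (*-congʳ x-0≈x) x*y≈1)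
    where
    x-0≈x : x - 0# ≈ x
    x-0≈x = trans (+-congˡ -0#≈0#) (+-identityʳ x)
  ... | no ∄y = contradiction (proj₁ (tight x 0#) λ x#0 → ∄y
    (E.from (x ⁻¹) , trans (*-congˡ (E.strictlyInverseˡ _)) (⁻¹-inverseʳ x#0))) x≉0

  inverse : ∀ {x} → ¬ x ≈ 0# → ∃ λ y → y * x ≈ 1#
  inverse {x} x≉0 = x ⁻¹ , ⁻¹-inverseˡ (≉⇒# x≉0)

  ≈0? : ∀ x → Dec (x ≈ 0#)
  ≈0? x = x ≟ 0#

  *-cancelˡ : ∀ {x y z} → ¬ x ≈ 0# → x * y ≈ x * z → y ≈ z
  *-cancelˡ {x} {y} {z} x≉0 xy≈xz = begin
    y                 ≈⟨ x⁻¹xy≈y y ⟨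
    x ⁻¹ * (x * y)    ≈⟨ *-congˡ xy≈xz ⟩
    x ⁻¹ * (x * z)    ≈⟨ x⁻¹xy≈y z ⟩
    z                 ∎
    where
    x⁻¹xy≈y : ∀ y → x ⁻¹ * (x * y) ≈ y
    x⁻¹xy≈y y = trans (sym (*-assoc _ x y)) (trans (*-congʳ (⁻¹-inverseˡ (≉⇒# x≉0))) (*-identityˡ y))

  integral : ∀ {x y} → x * y ≈ 0# → ¬ x ≈ 0# → y ≈ 0#
  integral {x} xy≈0 x≉0 = *-cancelˡ x≉0 (trans xy≈0 (sym (zeroʳ x)))

  *-≉0 : ∀ {x y} → ¬ x ≈ 0# → ¬ y ≈ 0# → ¬ x * y ≈ 0#
  *-≉0 x≉0 y≉0 xy≈0 = y≉0 (integral xy≈0 x≉0)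

  nontrivial : 1 ℕ.< N → ¬ 1# ≈ 0#
  nontrivial (s≤s (s≤s _)) 1≈0 = contradiction (all-equal zero (suc zero)) λ ()
    where
    all≈0 : ∀ x → x ≈ 0#
    all≈0 x = trans (sym (*-identityˡ x)) (trans (*-congʳ 1≈0) (zeroˡ x))
    all-equal : ∀ i j → i ≡ j
    all-equal i j = ≡.trans (≡.sym (E.strictlyInverseʳ i))
      (≡.trans (E.from-cong (trans (all≈0 _) (sym (all≈0 _)))) (E.strictlyInverseʳ j))

  to-injective : ∀ {i j} → E.to i ≈ E.to j → i ≡ j
  to-injective eq = ≡.trans (≡.sym (E.strictlyInverseʳ _)) (≡.trans (E.from-cong eq) (E.strictlyInverseʳ _))

  from-injective : ∀ {x y} → E.from x ≡ E.from y → x ≈ y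
  from-injective eq = trans (sym (E.strictlyInverseˡ _)) (trans (reflexive (≡.cong E.to eq)) (E.strictlyInverseˡ _))

  any? : ∀ {p} {P : Carrier → Set p} → (∀ {x y} → x ≈ y → P x → P y) → (∀ x → Dec (P x)) → Dec (∃ P)
  any? resp P? with Fin.any? (P? ⊙ E.to)
  ... | yes (i , p) = yes (E.to i , p)
  ... | no ∄        = no λ (x , p) → ∄ (E.from x , resp (sym (E.strictlyInverseˡ x)) p)

  module _ {f : Carrier → Carrier} (f-cong : Congruent _≈_ _≈_ f) where

    private
      f′ : Fin N → Fin N
      f′ = E.from ⊙ f ⊙ E.to

      f′∘from : ∀ x → f′ (E.from x) ≡ E.from (f x)
      f′∘from x = E.from-cong (f-cong (E.strictlyInverseˡ x))

    injective⇒surjective : Injective _≈_ _≈_ f → StrictlySurjective _≈_ f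
    injective⇒surjective f-inj y =
      let i , f′i≡ = Fin-injective⇒surjective f′ (λ eq → to-injective (f-inj (from-injective eq))) (E.from y)
      in E.to i , from-injective f′i≡

    surjective⇒injective : StrictlySurjective _≈_ f → Injective _≈_ _≈_ f
    surjective⇒injective f-surj {x} {y} fx≈fy = from-injective (Fin-surjective⇒injective f′ f′-surj
      (≡.trans (f′∘from x) (≡.trans (E.from-cong fx≈fy) (≡.sym (f′∘from y)))))
      where
      f′-surj : StrictlySurjective _≡_ f′
      f′-surj j = let x , fx≈ = f-surj (E.to j) in
        E.from x , ≡.trans (f′∘from x) (≡.trans (E.from-cong fx≈) (E.strictlyInverseʳ j))

  module _ {c′ ℓ′} (M : CommutativeMonoid c′ ℓ′) where

    private module M where
      open CommutativeMonoid M public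
      open Sum M public

    -- The monoid is arbitrary because the lemma serves the sum over the field in `N·1≈0` and the
    -- product in `x^N≈x`.
    sum-reindex : ∀ {φ : Carrier → M.Carrier} → Congruent _≈_ M._≈_ φ →
      ∀ {t t′} → Congruent _≈_ _≈_ t → Congruent _≈_ _≈_ t′ →
      (∀ x → t (t′ x) ≈ x) → (∀ x → t′ (t x) ≈ x) →
      M.sum (φ ⊙ E.to) M.≈ M.sum (φ ⊙ t ⊙ E.to)
    sum-reindex {φ} φ-cong {t} {t′} t-cong t′-cong tt′ t′t =
      M.trans (M.sum-permute (φ ⊙ E.to) π) (M.sum-cong-≋ λ i → φ-cong (E.strictlyInverseˡ (t (E.to i))))
      where
      conjugate : (Carrier → Carrier) → Fin N → Fin N
      conjugate s = E.from ⊙ s ⊙ E.to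

      conjugate-inverse : ∀ {s s′} → Congruent _≈_ _≈_ s → (∀ x → s (s′ x) ≈ x) →
        ∀ i → conjugate s (conjugate s′ i) ≡ i
      conjugate-inverse s-cong ss′ i = ≡.trans
        (E.from-cong (trans (s-cong (E.strictlyInverseˡ _)) (ss′ (E.to i)))) (E.strictlyInverseʳ i)

      π : Permutation′ N
      π = permutation (conjugate t) (conjugate t′)
        (conjugate-inverse t-cong tt′) (conjugate-inverse t′-cong t′t)

  -- Translation by 1 permutes the field, so Σ x = Σ (x + 1) = Σ x + N.
  N·1≈0 : N · 1# ≈ 0#
  N·1≈0 = +-identityʳ-unique (sum E.to) _ (begin
    sum E.to + N · 1#             ≈⟨ +-congˡ (sum-replicate N) ⟨
    sum E.to + sum {N} (λ _ → 1#) ≈⟨ ∑-distrib-+ E.to (λ _ → 1#) ⟨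
    sum (λ i → E.to i + 1#)       ≈⟨ sum-reindex +-commutativeMonoid (λ eq → eq) +-congʳ +-congʳ
                                       (λ x → trans (+-assoc x _ _) (trans (+-congˡ (-‿inverseˡ 1#)) (+-identityʳ x)))
                                       (λ x → trans (+-assoc x _ _) (trans (+-congˡ (-‿inverseʳ 1#)) (+-identityʳ x))) ⟨
    sum E.to                      ∎)

  private
    ifZero : Carrier → Carrier → Carrier → Carrier
    ifZero u v x with ≈0? x
    ... | yes _ = u
    ... | no _  = v

    ifZero-yes : ∀ {u v x} → x ≈ 0# → ifZero u v x ≈ u
    ifZero-yes {x = x} x≈0 with ≈0? x
    ... | yes _  = refl
    ... | no x≉0 = contradiction x≈0 x≉0

    ifZero-no : ∀ {u v x} → ¬ x ≈ 0# → ifZero u v x ≈ v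
    ifZero-no {x = x} x≉0 with ≈0? x
    ... | yes x≈0 = contradiction x≈0 x≉0
    ... | no _    = refl

    -- With 0 replaced by 1, the product over the whole enumeration is the product of the nonzero
    -- elements.
    unit : Carrier → Carrier
    unit x = ifZero 1# x x

    unit-cong : Congruent _≈_ _≈_ unit
    unit-cong {x} {y} x≈y with ≈0? x | ≈0? y
    ... | yes _   | yes _   = refl
    ... | yes x≈0 | no y≉0  = contradiction (trans (sym x≈y) x≈0) y≉0
    ... | no x≉0  | yes y≈0 = contradiction (trans x≈y y≈0) x≉0
    ... | no _    | no _    = x≈y

    -- `x * unit y` and `unit (x * y)` differ only at y = 0, where they are x and 1. This one
    -- surplus factor x survives in the product over the field and yields `x ^ N ≈ x`.
    unit-* : ∀ {x} → ¬ x ≈ 0# → ∀ y → x * unit y ≈ ifZero x 1# y * unit (x * y)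
    unit-* {x} x≉0 y with ≈0? y
    ... | yes y≈0 = *-congˡ (sym (ifZero-yes (trans (*-congˡ y≈0) (zeroʳ x))))
    ... | no y≉0  = trans (sym (*-identityˡ _)) (*-congˡ (sym (ifZero-no (*-≉0 x≉0 y≉0))))

    unit-≉0 : ¬ 1# ≈ 0# → ∀ x → ¬ unit x ≈ 0#
    unit-≉0 1≉0 x with ≈0? x
    ... | yes _  = 1≉0
    ... | no x≉0 = x≉0

    product-≉0 : ¬ 1# ≈ 0# → ∀ {n} (t : Vector Carrier n) → (∀ i → ¬ t i ≈ 0#) → ¬ Π.sum t ≈ 0#
    product-≉0 1≉0 {zero}  t t≉0 = 1≉0
    product-≉0 1≉0 {suc n} t t≉0 = *-≉0 (t≉0 zero) (product-≉0 1≉0 (t ⊙ suc) (t≉0 ⊙ suc))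

    product-single : ∀ {n x} (i : Fin n) (t : Vector Carrier n) →
      t i ≈ x → (∀ j → j ≢ i → t j ≈ 1#) → Π.sum t ≈ x
    product-single {suc n} {x} i t tᵢ≈x t≈1 = begin
      Π.sum t                        ≈⟨ Π.sum-remove {i = i} t ⟩
      t i * Π.sum (removeAt t i)     ≈⟨ *-cong tᵢ≈x (Π.sum-cong-≋ λ j → t≈1 _ (Fin.punchInᵢ≢i i j)) ⟩
      x * Π.sum (replicate n 1#)     ≈⟨ *-congˡ (Π.sum-replicate-zero n) ⟩
      x * 1#                         ≈⟨ *-identityʳ x ⟩
      x                              ∎

    pow-zero : ∀ n {x} → 0 ℕ.< n → x ≈ 0# → x ^ n ≈ x
    pow-zero (suc n) _ x≈0 = trans (*-congʳ x≈0) (trans (zeroˡ _) (sym x≈0))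

  -- For x ≠ 0, multiplication by x permutes the field; compare Π over the nonzero elements.
  x^N≈x : 1 ℕ.< N → ∀ x → x ^ N ≈ x
  x^N≈x 1<N x with ≈0? x
  ... | yes x≈0 = pow-zero N (ℕ.<-trans (s≤s z≤n) 1<N) x≈0
  ... | no x≉0  = *-cancelˡ (product-≉0 1≉0 (unit ⊙ E.to) (unit-≉0 1≉0 ⊙ E.to)) (begin
    Π.sum (unit ⊙ E.to) * x ^ N
      ≈⟨ *-comm _ _ ⟩
    x ^ N * Π.sum (unit ⊙ E.to)
      ≈⟨ *-congʳ (Π.sum-replicate N) ⟨
    Π.sum {N} (λ _ → x) * Π.sum (unit ⊙ E.to)
      ≈⟨ Π.∑-distrib-+ (λ _ → x) (unit ⊙ E.to) ⟨
    Π.sum (λ i → x * unit (E.to i))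
      ≈⟨ Π.sum-cong-≋ (unit-* x≉0 ⊙ E.to) ⟩
    Π.sum (λ i → ifZero x 1# (E.to i) * unit (x * E.to i))
      ≈⟨ Π.∑-distrib-+ (ifZero x 1# ⊙ E.to) (λ i → unit (x * E.to i)) ⟩
    Π.sum (ifZero x 1# ⊙ E.to) * Π.sum (λ i → unit (x * E.to i))
      ≈⟨ *-cong (product-single (E.from 0#) (ifZero x 1# ⊙ E.to)
                  (ifZero-yes (E.strictlyInverseˡ 0#))
                  (λ j j≢ → ifZero-no λ eq → j≢ (≡.trans (≡.sym (E.strictlyInverseʳ j)) (E.from-cong eq))))
                (sym (sum-reindex *-commutativeMonoid unit-cong *-congˡ *-congˡ
                  (λ y → trans (sym (*-assoc x _ y)) (trans (*-congʳ (⁻¹-inverseʳ (≉⇒# x≉0))) (*-identityˡ y)))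
                  (λ y → trans (sym (*-assoc _ x y)) (trans (*-congʳ (⁻¹-inverseˡ (≉⇒# x≉0))) (*-identityˡ y))))) ⟩
    x * Π.sum (unit ⊙ E.to)
      ≈⟨ *-comm _ _ ⟩
    Π.sum (unit ⊙ E.to) * x ∎)
    where
    1≉0 = nontrivial 1<N

  -- Cancels one x in `x ^ N ≈ x`. The form exhibits `x ^ (N ∸ 2)` as the inverse of x, including N
  -- = 2, where the exponent is 0.
  x^[N-1]≈1 : 1 ℕ.< N → ∀ {x} → ¬ x ≈ 0# → x * x ^ (N ℕ.∸ 2) ≈ 1#
  x^[N-1]≈1 (s≤s (s≤s _)) {x} x≉0 = *-cancelˡ x≉0 (trans (x^N≈x (s≤s (s≤s z≤n)) x) (sym (*-identityʳ x)))

  -- The map sending m to `m · 1#` is multiplicative and a field has no zero divisors, so one of the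
  -- m factors `p · 1#` vanishes.
  p^m·1≈0⇒p·1≈0 : ¬ 1# ≈ 0# → ∀ p m → (p ℕ.^ m) · 1# ≈ 0# → p · 1# ≈ 0#
  p^m·1≈0⇒p·1≈0 1≉0 p zero    eq = contradiction (trans (sym (+-identityʳ 1#)) eq) 1≉0
  p^m·1≈0⇒p·1≈0 1≉0 p (suc m) eq with ≈0? (p · 1#)
  ... | yes p·1≈0 = p·1≈0
  ... | no p·1≉0  = p^m·1≈0⇒p·1≈0 1≉0 p m
    (integral (trans (sym (×1-homo-* p (p ℕ.^ m))) eq) p·1≉0)

-- Binomial coefficients and the Frobenius map in characteristic p.

prime∤! : ∀ {p} → Prime p → ∀ {k} → k ℕ.< p → p ℕ∣.∤ k ℕ.!
prime∤! p-prime {zero}  k<p p∣1 = ℕ∣.>⇒∤ (ℕ.nonTrivial⇒n>1 _ {{prime⇒nonTrivial p-prime}}) p∣1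
prime∤! p-prime {suc k} k<p p∣ with euclidsLemma (suc k) (k ℕ.!) p-prime p∣
... | inj₁ p∣1+k = ℕ∣.>⇒∤ k<p p∣1+k
... | inj₂ p∣k!  = prime∤! p-prime (ℕ.<-trans (ℕ.n<1+n k) k<p) p∣k!

n∣n! : ∀ {n} → 0 ℕ.< n → n ℕ∣.∣ n ℕ.!
n∣n! {suc n} _ = ℕ∣.m∣m*n (n ℕ.!)

-- p divides p! = C(p, k) k! (p - k)!, but neither of the two factorials, whose factors are all
-- smaller than p.
prime∣C : ∀ {p} → Prime p → ∀ k → 0 ℕ.< k → k ℕ.< p → p ℕ∣.∣ p C k
prime∣C {p} p-prime k 0<k k<p
  with euclidsLemma (p C k) (k ℕ.! ℕ.* (p ℕ.∸ k) ℕ.!) p-prime (≡.subst (p ℕ∣.∣_) (≡.sym C*≡p!) p∣p!)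
  where
  instance _ = k ℕ.!* (p ℕ.∸ k) !≢0
  C*≡p! : (p C k) ℕ.* (k ℕ.! ℕ.* (p ℕ.∸ k) ℕ.!) ≡ p ℕ.!
  C*≡p! = ≡.trans (≡.cong (ℕ._* (k ℕ.! ℕ.* (p ℕ.∸ k) ℕ.!)) (nCk≡n!/k![n-k]! (ℕ.<⇒≤ k<p)))
    (ℕ/.m/n*n≡m (k![n∸k]!∣n! (ℕ.<⇒≤ k<p)))
  p∣p! : p ℕ∣.∣ p ℕ.!
  p∣p! = n∣n! (ℕ.<-trans 0<k k<p)
... | inj₁ p∣C = p∣C
... | inj₂ p∣* with euclidsLemma (k ℕ.!) ((p ℕ.∸ k) ℕ.!) p-prime p∣*
...   | inj₁ p∣k!   = contradiction p∣k! (prime∤! p-prime k<p)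
...   | inj₂ p∣p-k! = contradiction p∣p-k! (prime∤! p-prime (ℕ.∸-monoʳ-< 0<k (ℕ.<⇒≤ k<p)))

module Frobenius {c ℓ} (R : CommutativeRing c ℓ) where

  open CommutativeRing R hiding (zero)
  open Mult semiring using (×-congʳ; ×-assoc-*; ×1-homo-*) renaming (_×_ to _·_)
  open CommutativeExp commutativeSemiring using (_^_; ^-congˡ; ^-assocʳ)
  open SemiringSum semiring using (sum; sum-cong-≋; sum-init-last; sum-replicate-zero)
  open Binomial commutativeSemiring using (binomial; binomialTerm; theorem)
  open SetoidReasoning setoid

  module _ {p} (p-prime : Prime p) (p·1≈0 : p · 1# ≈ 0#) where

    p∣m⇒m·x≈0 : ∀ {m} → p ℕ∣.∣ m → ∀ x → m · x ≈ 0#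
    p∣m⇒m·x≈0 (ℕ∣.divides-refl k) x = begin
      (k ℕ.* p) · x         ≈⟨ ×-congʳ (k ℕ.* p) (*-identityˡ x) ⟨
      (k ℕ.* p) · (1# * x)  ≈⟨ ×-assoc-* (k ℕ.* p) 1# x ⟨
      (k ℕ.* p) · 1# * x    ≈⟨ *-congʳ (×1-homo-* k p) ⟩
      k · 1# * p · 1# * x   ≈⟨ *-congʳ (trans (*-congˡ p·1≈0) (zeroʳ _)) ⟩
      0# * x                ≈⟨ zeroˡ x ⟩
      0#                    ∎

    ^p-distrib-+ : ∀ x y → (x + y) ^ p ≈ x ^ p + y ^ p
    ^p-distrib-+ x y = go p ≡.refl
      where
      -- p is fixed by the module; a copy m of it can be matched as a successor, which splits the
      -- binomial sum into its first, middle and last terms.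
      go : ∀ m → m ≡ p → (x + y) ^ m ≈ x ^ m + y ^ m
      go zero     m≡p = contradiction m≡p λ { ≡.refl → ¬prime[0] p-prime }
      go (suc m) ≡.refl = begin
        (x + y) ^ suc m
          ≈⟨ theorem (suc m) x y ⟩
        1 · (1# * y ^ suc m) + sum {suc m} (λ k → binomialTerm x y (suc m) (suc k))
          ≈⟨ +-cong (trans (+-identityʳ _) (*-identityˡ _)) (sum-init-last (λ k → binomialTerm x y (suc m) (suc k))) ⟩
        y ^ suc m + (sum {m} (λ k → binomialTerm x y (suc m) (suc (inject₁ k))) + binomialTerm x y (suc m) (suc (fromℕ m)))
          ≈⟨ +-congˡ (+-cong (trans (sum-cong-≋ middle) (sum-replicate-zero m)) top) ⟩
        y ^ suc m + (0# + x ^ suc m)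
          ≈⟨ trans (+-congˡ (+-identityˡ _)) (+-comm _ _) ⟩
        x ^ suc m + y ^ suc m ∎
        where
        middle : ∀ k → binomialTerm x y (suc m) (suc (inject₁ k)) ≈ 0#
        middle k = p∣m⇒m·x≈0 (prime∣C p-prime _ (s≤s z≤n)
          (s≤s (≡.subst (ℕ._< m) (≡.sym (Fin.toℕ-inject₁ k)) (Fin.toℕ<n k)))) (binomial x y (suc m) (suc (inject₁ k)))

        top : binomialTerm x y (suc m) (suc (fromℕ m)) ≈ x ^ suc m
        top rewrite Fin.toℕ-fromℕ m | nCn≡1 (suc m) | ℕ.n∸n≡0 m =
          trans (+-identityʳ _) (*-identityʳ _)

    ^pʳ-distrib-+ : ∀ r x y → (x + y) ^ (p ℕ.^ r) ≈ x ^ (p ℕ.^ r) + y ^ (p ℕ.^ r)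
    ^pʳ-distrib-+ zero    x y = trans (*-identityʳ _) (sym (+-cong (*-identityʳ x) (*-identityʳ y)))
    ^pʳ-distrib-+ (suc r) x y = begin
      (x + y) ^ (p ℕ.* p ℕ.^ r)                         ≈⟨ ^-assocʳ (x + y) p _ ⟨
      ((x + y) ^ p) ^ (p ℕ.^ r)                         ≈⟨ ^-congˡ (p ℕ.^ r) (^p-distrib-+ x y) ⟩
      (x ^ p + y ^ p) ^ (p ℕ.^ r)                       ≈⟨ ^pʳ-distrib-+ r (x ^ p) (y ^ p) ⟩
      (x ^ p) ^ (p ℕ.^ r) + (y ^ p) ^ (p ℕ.^ r)         ≈⟨ +-cong (^-assocʳ x p _) (^-assocʳ y p _) ⟩
      x ^ (p ℕ.* p ℕ.^ r) + y ^ (p ℕ.* p ℕ.^ r)         ∎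

-- A cancellation identity and powers of natural numbers.

module _ {c ℓ} (R : CommutativeRing c ℓ) where

  open CommutativeRing R
  open RingProperties ring using (+-identityʳ-unique)
  open SemiringSolver commutativeSemiring using (solve; _:=_; _:+_; _:*_)
  open SetoidReasoning setoid

  -- Here 1 - s = - e g and a g / N = 1. It is applied with s = h(a) H(a), g = g_a(a) and N = n, and
  -- shows that the constant in `M` cancels e(a).
  fraction-cancel : ∀ {a e g s N N⁻¹} → a * g ≈ N → N * N⁻¹ ≈ 1# → s ≈ 1# + e * g →
    a * ((1# - s) * N⁻¹) + e ≈ 0#
  fraction-cancel {a} {e} {g} {s} {N} {N⁻¹} ag≈N NN⁻¹≈1 s≈1+eg = begin
    a * ((1# - s) * N⁻¹) + e
      ≈⟨ +-congˡ (trans (*-congˡ (trans (*-congʳ ag≈N) NN⁻¹≈1)) (*-identityʳ e)) ⟨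
    a * ((1# - s) * N⁻¹) + e * (a * g * N⁻¹)
      ≈⟨ solve 5 (λ a d n e g → (a :* (d :* n) :+ e :* (a :* g :* n)) := (a :* n :* (d :+ e :* g)))
           refl a (1# - s) N⁻¹ e g ⟩
    a * N⁻¹ * (1# - s + e * g)
      ≈⟨ *-congˡ (+-identityʳ-unique 1# _ 1+1-s+eg≈1) ⟩
    a * N⁻¹ * 0#
      ≈⟨ zeroʳ _ ⟩
    0# ∎
    where
    1+1-s+eg≈1 : 1# + (1# - s + e * g) ≈ 1#
    1+1-s+eg≈1 = begin
      1# + (1# - s + e * g)
        ≈⟨ solve 3 (λ o d x → (o :+ (d :+ x)) := (d :+ (o :+ x))) refl 1# (1# - s) (e * g) ⟩
      1# - s + (1# + e * g)  ≈⟨ +-congˡ s≈1+eg ⟨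
      1# - s + s             ≈⟨ trans (+-assoc 1# _ s) (+-congˡ (-‿inverseˡ s)) ⟩
      1# + 0#                ≈⟨ +-identityʳ 1# ⟩
      1#                     ∎

1<m^k : ∀ {m k} → 1 ℕ.< m → 0 ℕ.< k → 1 ℕ.< m ℕ.^ k
1<m^k 1<m 0<k = ℕ.^-monoʳ-< _ 1<m 0<k

^-injectiveʳ : ∀ {m} → 1 ℕ.< m → ∀ {i j} → m ℕ.^ i ≡ m ℕ.^ j → i ≡ j
^-injectiveʳ {m} 1<m {i} {j} eq with ℕ.<-cmp i j
... | tri< i<j _ _ = contradiction eq (ℕ.<⇒≢ (ℕ.^-monoʳ-< m 1<m i<j))
... | tri≈ _ i≡j _ = i≡j
... | tri> _ _ j<i = contradiction (≡.sym eq) (ℕ.<⇒≢ (ℕ.^-monoʳ-< m 1<m j<i))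

-- The operators `Λ u`.

module LinearizedOperators {c₁ ℓ₁ ℓ₁′ c₂ ℓ₂ ℓ₂′ q n} (E : FiniteFieldExtension c₁ ℓ₁ ℓ₁′ c₂ ℓ₂ ℓ₂′ q n)
  {p r} (p-prime : Prime p) (0<r : 0 ℕ.< r) (q≡p^r : q ≡ p ℕ.^ r) (0<n : 0 ℕ.< n) where

  open Extension E
  open FiniteFieldExtension E using (base; top; ι-isRingMonomorphism)
  private
    module F-ring = CommutativeRing F.commutativeRing
    module F-mult = Mult F-ring.semiring
    module FF     = FiniteFieldProperties base
    module KF     = FiniteFieldProperties top
    module FE     = Inverse (FiniteField.enumeration base)
    module KE     = Inverse (FiniteField.enumeration top)
    module Fᵖ     = PolynomialRing F.commutativeRing
    module Kᵖ     = PolynomialRing K.commutativeRing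
    module Fᶜ     = Coefficients F.commutativeRing
    module Kᶜ     = Coefficients K.commutativeRing
    module Fᴱ     = Evaluation F.commutativeRing
    module Fᴰ     = Division F.commutativeRing
    module Kᴰ     = Division K.commutativeRing
    module F[x]ᴿ  = CommutativeRing Fᵖ.polynomialRing
  open CommutativeRing K.commutativeRing hiding (zero)
  open RingProperties ring using
    (-0#≈0#; -‿distribˡ-*; x∙y⁻¹≈ε⇒x≈y; x≈y⇒x∙y⁻¹≈ε; +-inverseʳ-unique; +-identityˡ-unique; +-cancelˡ)
  open CommutativeExp commutativeSemiring using (_^_; ^-congˡ; ^-assocʳ; ^-distrib-*)
  open Mult semiring using () renaming (_×_ to _·_)
  open SemiringSum semiring using (sum; sum-cong-≋; *-distribˡ-sum)
  open K[x] using (eval)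
  open Evaluation K.commutativeRing
  open Kᵖ using (_≋_; pointwise; at)
  open Fᵖ using () renaming (_≋_ to _≋ᶠ_)
  open SemiringSolver commutativeSemiring using (solve; _:=_; _:+_; _:*_)
  open SetoidReasoning setoid
  open RingMorphisms F.rawRing K.rawRing using (module IsRingMonomorphism)
  open IsRingMonomorphism ι-isRingMonomorphism public
    using () renaming (⟦⟧-cong to ι-cong; injective to ι-injective; +-homo to ι-+; *-homo to ι-*;
                       0#-homo to ι-0; 1#-homo to ι-1; -‿homo to ι-neg)

  1<q : 1 ℕ.< q
  1<q = ≡.subst (1 ℕ.<_) (≡.sym q≡p^r) (1<m^k (ℕ.nonTrivial⇒n>1 p {{prime⇒nonTrivial p-prime}}) 0<r)

  1<q^n : 1 ℕ.< q ℕ.^ n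
  1<q^n = 1<m^k 1<q 0<n

  ι-≉0 : ∀ {c} → ¬ c F.≈ F.0# → ¬ ι c ≈ 0#
  ι-≉0 c≉0 ιc≈0 = c≉0 (ι-injective (trans ιc≈0 (sym ι-0)))

  ι-^ : ∀ c m → ι (c F.^ m) ≈ ι c ^ m
  ι-^ c zero    = ι-1
  ι-^ c (suc m) = trans (ι-* c _) (*-congˡ (ι-^ c m))

  p·1≈0ᶠ : p F.· F.1# F.≈ F.0#
  p·1≈0ᶠ = FF.p^m·1≈0⇒p·1≈0 (FF.nontrivial 1<q) p r
    (≡.subst (λ N → N F.· F.1# F.≈ F.0#) q≡p^r FF.N·1≈0)

  p·1≈0 : p · 1# ≈ 0#
  p·1≈0 = KF.p^m·1≈0⇒p·1≈0 (KF.nontrivial 1<q^n) p (r ℕ.* n)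
    (≡.subst (λ N → N · 1# ≈ 0#) (≡.trans (≡.cong (ℕ._^ n) q≡p^r) (ℕ.^-*-assoc p r n)) KF.N·1≈0)

  p∣n⇒n·1≈0 : p ℕ∣.∣ n → n F.· F.1# F.≈ F.0#
  p∣n⇒n·1≈0 p∣n = Frobenius.p∣m⇒m·x≈0 F.commutativeRing p-prime p·1≈0ᶠ p∣n F.1#

  -- If p did not divide n, a Bézout relation would make multiples of p and of n differ by 1. All
  -- such multiples vanish in 𝔽_q, so 1 would vanish too.
  n·1≈0⇒p∣n : n F.· F.1# F.≈ F.0# → p ℕ∣.∣ n
  n·1≈0⇒p∣n n·1≈0 with p ℕ∣.∣? n
  ... | yes p∣n = p∣n
  ... | no p∤n  = contradiction 1≈0 (FF.nontrivial 1<q)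
    where
    coprime : Coprime p n
    coprime (d∣p , d∣n) with prime⇒irreducible p-prime d∣p
    ... | inj₁ d≡1    = d≡1
    ... | inj₂ ≡.refl = contradiction d∣n p∤n

    multiple≈0 : ∀ {m} → m F.· F.1# F.≈ F.0# → ∀ k → (k ℕ.* m) F.· F.1# F.≈ F.0#
    multiple≈0 m·1≈0 k = F-ring.trans (F-mult.×1-homo-* k _) (F-ring.trans (F-ring.*-congˡ m·1≈0) (F-ring.zeroʳ _))

    conclude : ∀ {k l} → 1 ℕ.+ k ≡ l → k F.· F.1# F.≈ F.0# → l F.· F.1# F.≈ F.0# → F.1# F.≈ F.0#
    conclude {k} ≡.refl k≈0 1+k≈0 =
      F-ring.trans (F-ring.sym (F-ring.trans (F-ring.+-congˡ k≈0) (F-ring.+-identityʳ _))) 1+k≈0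

    1≈0 : F.1# F.≈ F.0#
    1≈0 with coprime-Bézout coprime
    ... | Bézout.+- x y eq = conclude eq (multiple≈0 n·1≈0 y) (multiple≈0 p·1≈0ᶠ x)
    ... | Bézout.-+ x y eq = conclude eq (multiple≈0 p·1≈0ᶠ x) (multiple≈0 n·1≈0 y)

  σ : Carrier → Carrier
  σ x = x ^ q

  σ-cong : ∀ {x y} → x ≈ y → σ x ≈ σ y
  σ-cong = ^-congˡ q

  σ-+ : ∀ x y → σ (x + y) ≈ σ x + σ y
  σ-+ x y = ≡.subst (λ m → (x + y) ^ m ≈ x ^ m + y ^ m) (≡.sym q≡p^r)
    (Frobenius.^pʳ-distrib-+ K.commutativeRing p-prime p·1≈0 r x y)

  σ-* : ∀ x y → σ (x * y) ≈ σ x * σ y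
  σ-* x y = ^-distrib-* x y q

  σ-ι : ∀ c → σ (ι c) ≈ ι c
  σ-ι c = trans (sym (ι-^ c q)) (ι-cong (FF.x^N≈x 1<q c))

  σ-0 : σ 0# ≈ 0#
  σ-0 = trans (σ-cong (sym ι-0)) (trans (σ-ι F.0#) ι-0)

  σ-ι* : ∀ c x → σ (ι c * x) ≈ ι c * σ x
  σ-ι* c x = trans (σ-* _ x) (*-congʳ (σ-ι c))

  ^q^suc : ∀ x m → x ^ (q ℕ.^ suc m) ≈ σ x ^ (q ℕ.^ m)
  ^q^suc x m = sym (^-assocʳ x q (q ℕ.^ m))

  -- The function induced by `L u`, see `eval-L`. The recursion applies σ to the argument, so that
  -- the powers `q ^ i` disappear from the algebra.
  Λ : F[x].Poly → Carrier → Carrier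
  Λ []      x = 0#
  Λ (c ∷ u) x = ι c * x + Λ u (σ x)

  Λ-cong : ∀ u {x y} → x ≈ y → Λ u x ≈ Λ u y
  Λ-cong []      x≈y = refl
  Λ-cong (c ∷ u) x≈y = +-cong (*-congˡ x≈y) (Λ-cong u (σ-cong x≈y))

  Λ-+ : ∀ u x y → Λ u (x + y) ≈ Λ u x + Λ u y
  Λ-+ []      x y = sym (+-identityˡ 0#)
  Λ-+ (c ∷ u) x y = trans (+-congˡ (trans (Λ-cong u (σ-+ x y)) (Λ-+ u (σ x) (σ y))))
    (solve 5 (λ c x y u v → (c :* (x :+ y) :+ (u :+ v)) := ((c :* x :+ u) :+ (c :* y :+ v))) refl _ x y _ _)

  Λ-ι* : ∀ u c x → Λ u (ι c * x) ≈ ι c * Λ u x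
  Λ-ι* []      c x = sym (zeroʳ _)
  Λ-ι* (d ∷ u) c x = trans (+-congˡ (trans (Λ-cong u (σ-ι* c x)) (Λ-ι* u c (σ x))))
    (solve 4 (λ c d x u → (d :* (c :* x) :+ c :* u) := (c :* (d :* x :+ u))) refl _ _ x _)

  Λ-0 : ∀ u → Λ u 0# ≈ 0#
  Λ-0 u = begin
    Λ u 0#              ≈⟨ Λ-cong u (trans (*-congʳ ι-0) (zeroˡ 0#)) ⟨
    Λ u (ι F.0# * 0#)   ≈⟨ Λ-ι* u F.0# 0# ⟩
    ι F.0# * Λ u 0#     ≈⟨ trans (*-congʳ ι-0) (zeroˡ _) ⟩
    0#                  ∎

  Λ-σ : ∀ u x → Λ u (σ x) ≈ σ (Λ u x)
  Λ-σ []      x = sym σ-0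
  Λ-σ (c ∷ u) x = begin
    ι c * σ x + Λ u (σ (σ x))    ≈⟨ +-cong (sym (σ-ι* c x)) (Λ-σ u (σ x)) ⟩
    σ (ι c * x) + σ (Λ u (σ x))  ≈⟨ σ-+ _ _ ⟨
    σ (ι c * x + Λ u (σ x))      ∎

  Λ-[] : ∀ u x → u ≋ᶠ [] → Λ u x ≈ 0#
  Λ-[] []      x u≋0 = refl
  Λ-[] (c ∷ u) x u≋0 = begin
    ι c * x + Λ u (σ x)  ≈⟨ +-cong (*-congʳ (trans (ι-cong (Fᵖ.at u≋0 0)) ι-0))
                                   (Λ-[] u (σ x) (Fᵖ.pointwise λ i → Fᵖ.at u≋0 (suc i))) ⟩
    0# * x + 0#          ≈⟨ trans (+-identityʳ _) (zeroˡ x) ⟩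
    0#                   ∎

  Λ-congˡ : ∀ u v {x} → u ≋ᶠ v → Λ u x ≈ Λ v x
  Λ-congˡ []      v       u≋v = sym (Λ-[] v _ (F[x]ᴿ.sym u≋v))
  Λ-congˡ (c ∷ u) []      u≋v = Λ-[] (c ∷ u) _ u≋v
  Λ-congˡ (c ∷ u) (d ∷ v) u≋v = +-cong (*-congʳ (ι-cong (Fᵖ.at u≋v 0)))
    (Λ-congˡ u v (Fᵖ.pointwise λ i → Fᵖ.at u≋v (suc i)))

  Λ-+ˡ : ∀ u v x → Λ (u F[x].+ v) x ≈ Λ u x + Λ v x
  Λ-+ˡ []      v       x = sym (+-identityˡ _)
  Λ-+ˡ (c ∷ u) []      x = sym (+-identityʳ _)
  Λ-+ˡ (c ∷ u) (d ∷ v) x = trans (+-cong (*-congʳ (ι-+ c d)) (Λ-+ˡ u v (σ x)))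
    (solve 5 (λ c d x u v → ((c :+ d) :* x :+ (u :+ v)) := ((c :* x :+ u) :+ (d :* x :+ v))) refl _ _ x _ _)

  Λ-neg : ∀ u x → Λ (F[x].- u) x ≈ - Λ u x
  Λ-neg u x = +-inverseʳ-unique _ _ (trans (sym (Λ-+ˡ u (F[x].- u) x))
    (Λ-[] (u F[x].- u) x (F[x]ᴿ.-‿inverseʳ u)))

  Λ-scale : ∀ c u x → Λ (Fᵖ.scale c u) x ≈ ι c * Λ u x
  Λ-scale c []      x = sym (zeroʳ _)
  Λ-scale c (d ∷ u) x = trans (+-cong (*-congʳ (ι-* c d)) (Λ-scale c u (σ x)))
    (solve 4 (λ c d x u → ((c :* d) :* x :+ c :* u) := (c :* (d :* x :+ u))) refl _ _ x _)

  Λ-0∷ : ∀ u x → Λ (F.0# ∷ u) x ≈ Λ u (σ x)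
  Λ-0∷ u x = trans (+-congʳ (trans (*-congʳ ι-0) (zeroˡ x))) (+-identityˡ _)

  -- The coefficients lie in 𝔽_q and are fixed by σ, so `Λ v` commutes with σ; therefore composition
  -- of operators is the ordinary product of polynomials.
  Λ-* : ∀ u v x → Λ (u F[x].* v) x ≈ Λ u (Λ v x)
  Λ-* []      v x = refl
  Λ-* (c ∷ u) v x = begin
    Λ (Fᵖ.scale c v F[x].+ (F.0# ∷ u F[x].* v)) x     ≈⟨ Λ-+ˡ (Fᵖ.scale c v) _ x ⟩
    Λ (Fᵖ.scale c v) x + Λ (F.0# ∷ u F[x].* v) x      ≈⟨ +-cong (Λ-scale c v x) (Λ-0∷ (u F[x].* v) x) ⟩
    ι c * Λ v x + Λ (u F[x].* v) (σ x)                ≈⟨ +-congˡ (trans (Λ-* u v (σ x)) (Λ-cong u (Λ-σ v x))) ⟩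
    ι c * Λ v x + Λ u (σ (Λ v x))                     ∎

  Λ-*-0 : ∀ u v {x} → Λ v x ≈ 0# → Λ (u F[x].* v) x ≈ 0#
  Λ-*-0 u v {x} Λvx≈0 = trans (Λ-* u v x) (trans (Λ-cong u Λvx≈0) (Λ-0 u))

  Λ-*-comm : ∀ u v x → Λ u (Λ v x) ≈ Λ v (Λ u x)
  Λ-*-comm u v x = begin
    Λ u (Λ v x)       ≈⟨ Λ-* u v x ⟨
    Λ (u F[x].* v) x  ≈⟨ Λ-congˡ (u F[x].* v) _ (F[x]ᴿ.*-comm u v) ⟩
    Λ (v F[x].* u) x  ≈⟨ Λ-* v u x ⟩
    Λ v (Λ u x)       ∎

  Λ-1 : ∀ x → Λ F[x].1# x ≈ x
  Λ-1 x = trans (+-identityʳ _) (trans (*-congʳ ι-1) (*-identityˡ x))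

  Λ-X^ : ∀ m x → Λ (F[x].X F[x].^ m) x ≈ x ^ (q ℕ.^ m)
  Λ-X^ zero    x = trans (Λ-1 x) (sym (*-identityʳ x))
  Λ-X^ (suc m) x = begin
    Λ (F[x].X F[x].* F[x].X F[x].^ m) x  ≈⟨ Λ-congˡ (F[x].X F[x].^ suc m) _ (Fᵖ.X-* _) ⟩
    Λ (F.0# ∷ F[x].X F[x].^ m) x         ≈⟨ Λ-0∷ (F[x].X F[x].^ m) x ⟩
    Λ (F[x].X F[x].^ m) (σ x)            ≈⟨ Λ-X^ m (σ x) ⟩
    σ x ^ (q ℕ.^ m)                      ≈⟨ ^q^suc x m ⟨
    x ^ (q ℕ.^ suc m)                    ∎

  xⁿ-1 : F[x].Poly
  xⁿ-1 = F[x].X F[x].^ n F[x].- F[x].1#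

  Λ-xⁿ-1 : ∀ x → Λ xⁿ-1 x ≈ 0#
  Λ-xⁿ-1 x = begin
    Λ xⁿ-1 x                                          ≈⟨ Λ-+ˡ (F[x].X F[x].^ n) _ x ⟩
    Λ (F[x].X F[x].^ n) x + Λ (F[x].- F[x].1#) x      ≈⟨ +-cong (Λ-X^ n x) (trans (Λ-neg F[x].1# x) (-‿cong (Λ-1 x))) ⟩
    x ^ (q ℕ.^ n) - x                                 ≈⟨ x≈y⇒x∙y⁻¹≈ε (KF.x^N≈x 1<q^n x) ⟩
    0#                                                ∎

  coeff-map-ι : ∀ u i → K[x].coeff (map ι u) i ≈ ι (F[x].coeff u i)
  coeff-map-ι []      i       = sym ι-0
  coeff-map-ι (c ∷ u) zero    = refl
  coeff-map-ι (c ∷ u) (suc i) = coeff-map-ι u i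

  private
    ev : F[x].Poly → Carrier → Carrier
    ev u = K[x].eval (map ι u)

    ev-cong : ∀ u v {x} → u ≋ᶠ v → ev u x ≈ ev v x
    ev-cong u v u≋v = eval-cong (map ι u) (map ι v)
      (pointwise λ i → trans (coeff-map-ι u i) (trans (ι-cong (Fᵖ.at u≋v i)) (sym (coeff-map-ι v i)))) refl

    ev-+ : ∀ u v x → ev (u F[x].+ v) x ≈ ev u x + ev v x
    ev-+ []      v       x = sym (+-identityˡ _)
    ev-+ (c ∷ u) []      x = sym (+-identityʳ _)
    ev-+ (c ∷ u) (d ∷ v) x = trans (+-cong (ι-+ c d) (*-congˡ (ev-+ u v x)))
      (solve 5 (λ c d x u v → ((c :+ d) :+ x :* (u :+ v)) := ((c :+ x :* u) :+ (d :+ x :* v))) refl _ _ x _ _)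

    ev-scale : ∀ c u x → ev (Fᵖ.scale c u) x ≈ ι c * ev u x
    ev-scale c []      x = sym (zeroʳ _)
    ev-scale c (d ∷ u) x = trans (+-cong (ι-* c d) (*-congˡ (ev-scale c u x)))
      (solve 4 (λ c d x u → (c :* d :+ x :* (c :* u)) := (c :* (d :+ x :* u))) refl _ _ x _)

    ev-X^ : ∀ m x → ev (F[x].X F[x].^ m) x ≈ x ^ m
    ev-X^ zero    x = trans (+-cong ι-1 (zeroʳ x)) (+-identityʳ 1#)
    ev-X^ (suc m) x = begin
      ev (F[x].X F[x].^ suc m) x      ≈⟨ ev-cong (F[x].X F[x].^ suc m) _ (Fᵖ.X-* _) ⟩
      ι F.0# + x * ev (F[x].X F[x].^ m) x  ≈⟨ +-cong ι-0 (*-congˡ (ev-X^ m x)) ⟩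
      0# + x * x ^ m                  ≈⟨ +-identityˡ _ ⟩
      x * x ^ m                       ∎

    -- In the induction the exponents shift and y becomes `σ y`, whereas the point of evaluation x
    -- stays; the hypothesis ties the two together. The case needed is x = y with exponents `q ^ k`.
    ev-sparse : ∀ e u x y → (∀ k → x ^ e k ≈ y ^ (q ℕ.^ k)) → ev (Fᶜ.sparse e u) x ≈ Λ u y
    ev-sparse e []      x y x^e≈ = refl
    ev-sparse e (c ∷ u) x y x^e≈ = begin
      ev (F[x].C c F[x].* F[x].X F[x].^ e 0 F[x].+ Fᶜ.sparse (e ⊙ suc) u) x
        ≈⟨ ev-+ (F[x].C c F[x].* F[x].X F[x].^ e 0) _ x ⟩
      ev (F[x].C c F[x].* F[x].X F[x].^ e 0) x + ev (Fᶜ.sparse (e ⊙ suc) u) x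
        ≈⟨ +-cong (trans (ev-cong (F[x].C c F[x].* F[x].X F[x].^ e 0) _ (Fᵖ.C-* c _)) (ev-scale c (F[x].X F[x].^ e 0) x))
                  (ev-sparse (e ⊙ suc) u x (σ y) (λ k → trans (x^e≈ (suc k)) (^q^suc y k))) ⟩
      ι c * ev (F[x].X F[x].^ e 0) x + Λ u (σ y)
        ≈⟨ +-congʳ (*-congˡ (trans (ev-X^ (e 0) x) (trans (x^e≈ 0) (*-identityʳ y)))) ⟩
      ι c * y + Λ u (σ y) ∎

  eval-L : ∀ u x → K[x].eval (L u) x ≈ Λ u x
  eval-L u x = ev-sparse (q ℕ.^_) u x x (λ k → refl)

  open RootCounting K.commutativeRing using (roots⇒0)

  -- The powers σ⁰, …, σⁿ⁻¹ are linearly independent because L u has degree below |K|.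
  Λ-independent : ∀ u → F[x].DegreeBelow n u → (∀ x → Λ u x ≈ 0#) → u ≋ᶠ []
  Λ-independent u u-below Λu≈0 = Fᵖ.pointwise λ i → ι-injective (begin
    ι (F[x].coeff u i)                              ≈⟨ ι-cong (Fᶜ.coeff-sparse (q ℕ.^_) (^-injectiveʳ 1<q) u i) ⟨
    ι (F[x].coeff (F[x].linearized q u) (q ℕ.^ i))  ≈⟨ coeff-map-ι (F[x].linearized q u) (q ℕ.^ i) ⟨
    K[x].coeff (L u) (q ℕ.^ i)                      ≈⟨ at Lu≋0 (q ℕ.^ i) ⟩
    0#                                              ≈⟨ ι-0 ⟨
    ι F.0#                                          ∎)
    where
    Lu-below : K[x].DegreeBelow (q ℕ.^ n) (L u)
    Lu-below j q^n≤j = trans (coeff-map-ι (F[x].linearized q u) j) (trans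
      (ι-cong (Fᶜ.coeff-sparse-other (q ℕ.^_) u j λ k → case k ℕ.<? n of λ where
        (yes k<n) → inj₂ (ℕ.>⇒≢ (ℕ.<-≤-trans (ℕ.^-monoʳ-< q 1<q k<n) q^n≤j))
        (no k≮n)  → inj₁ (u-below k (ℕ.≮⇒≥ k≮n)))) ι-0)

    Lu≋0 : L u ≋ []
    Lu≋0 = roots⇒0 KF.integral (q ℕ.^ n) (L u) Lu-below KE.to KF.to-injective
      (λ i → trans (eval-L u (KE.to i)) (Λu≈0 (KE.to i)))

  -- If z were outside the image of ι, the polynomial X^q - X of degree q would have q + 1 roots,
  -- namely z and the q elements of 𝔽_q.
  fixed⇒ι : ∀ {z} → σ z ≈ z → ∃ λ t → ι t ≈ z
  fixed⇒ι {z} σz≈z with FF.any? (λ s≈t ιs≈z → trans (ι-cong (F-ring.sym s≈t)) ιs≈z) (λ t → ι t K.≟ z)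
  ... | yes hit = hit
  ... | no miss = contradiction (begin
      1#                                          ≈⟨ +-identityʳ 1# ⟨
      1# + 0#                                     ≈⟨ +-cong (Kᶜ.coeff-X^-same q) (trans (-‿cong (coeff-X-q 1<q)) -0#≈0#) ⟨
      K[x].coeff X^q q - K[x].coeff K[x].X q      ≈⟨ coeff-u q ⟨
      K[x].coeff u q                              ≈⟨ at u≋0 q ⟩
      0#                                          ∎)
      (KF.nontrivial 1<q^n)
    where
    X^q = K[x].X K[x].^ q
    u   = X^q K[x].- K[x].X

    coeff-u : ∀ i → K[x].coeff u i ≈ K[x].coeff X^q i - K[x].coeff K[x].X i
    coeff-u i = trans (Kᵖ.coeff-+ X^q (K[x].- K[x].X) i) (+-congˡ (Kᵖ.coeff-neg K[x].X i))

    coeff-X-q : ∀ {i} → 1 ℕ.< i → K[x].coeff K[x].X i ≈ 0#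
    coeff-X-q (s≤s (s≤s _)) = refl

    u-below : K[x].DegreeBelow (suc q) u
    u-below i q<i = trans (coeff-u i) (trans (+-cong (Kᶜ.coeff-X^-other q (ℕ.>⇒≢ q<i))
      (-‿cong (coeff-X-q (ℕ.<-trans 1<q q<i)))) (-‿inverseʳ 0#))

    root : ∀ {x} → σ x ≈ x → K[x].eval u x ≈ 0#
    root {x} σx≈x = trans (eval-+ X^q (K[x].- K[x].X) x) (trans
      (+-cong (trans (eval-^ K[x].X q x) (trans (σ-cong (eval-X x)) σx≈x))
              (trans (eval-neg K[x].X x) (-‿cong (eval-X x))))
      (-‿inverseʳ x))

    point : Fin (suc q) → Carrier
    point zero    = z
    point (suc i) = ι (FE.to i)

    point-injective : ∀ {i j} → point i ≈ point j → i ≡ j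
    point-injective {zero}  {zero}  eq = ≡.refl
    point-injective {zero}  {suc j} eq = contradiction (FE.to j , sym eq) miss
    point-injective {suc i} {zero}  eq = contradiction (FE.to i , eq) miss
    point-injective {suc i} {suc j} eq = ≡.cong suc (FF.to-injective (ι-injective eq))

    u≋0 : u ≋ []
    u≋0 = roots⇒0 KF.integral (suc q) u u-below point point-injective λ where
      zero    → root σz≈z
      (suc i) → root (σ-ι (FE.to i))

  open Euclid F.commutativeRing using (coprime⇒bézout)
  open Division F.commutativeRing using (HasDegree; divMod; cofactor-unit)

  xⁿ-1-degree : HasDegree n xⁿ-1
  xⁿ-1-degree = record
    { below = λ i n<i → F-ring.trans (coeff-xⁿ-1 i (ℕ.<-trans 0<n n<i)) (Fᶜ.coeff-X^-other n (ℕ.>⇒≢ n<i))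
    ; lead⁻¹ = F.1#
    ; lead⁻¹*lead = F-ring.trans (F-ring.*-identityˡ _) (F-ring.trans (coeff-xⁿ-1 n 0<n) (Fᶜ.coeff-X^-same n)) }
    where
    coeff-1 : ∀ {i} → 0 ℕ.< i → F[x].coeff F[x].1# i F.≈ F.0#
    coeff-1 (s≤s _) = F-ring.refl

    coeff-xⁿ-1 : ∀ i → 0 ℕ.< i → F[x].coeff xⁿ-1 i F.≈ F[x].coeff (F[x].X F[x].^ n) i
    coeff-xⁿ-1 i 0<i = F-ring.trans (Fᵖ.coeff-+ (F[x].X F[x].^ n) _ i) (F-ring.trans
      (F-ring.+-congˡ (F-ring.trans (Fᵖ.coeff-neg F[x].1# i) (F-ring.trans (F-ring.-‿cong (coeff-1 0<i))
        (RingProperties.-0#≈0# F-ring.ring))))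
      (F-ring.+-identityʳ _))

  -- The remainder of u modulo xⁿ - 1 induces the same zero operator and has degree below n, so
  -- linear independence makes it zero.
  Λ≈0⇒xⁿ-1∣ : ∀ u → (∀ x → Λ u x ≈ 0#) → ∃ λ s → u ≋ᶠ s F[x].* xⁿ-1
  Λ≈0⇒xⁿ-1∣ u Λu≈0 with s , v , v-below , u≋ ← divMod xⁿ-1-degree u =
    s , F[x]ᴿ.trans u≋ (F[x]ᴿ.trans (F[x]ᴿ.+-congˡ {s F[x].* xⁿ-1} (Λ-independent v v-below Λv≈0)) (F[x]ᴿ.+-identityʳ _))
    where
    Λv≈0 : ∀ x → Λ v x ≈ 0#
    Λv≈0 x = begin
      Λ v x                            ≈⟨ +-identityˡ _ ⟨
      0# + Λ v x                       ≈⟨ +-congʳ (Λ-*-0 s xⁿ-1 (Λ-xⁿ-1 x)) ⟨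
      Λ (s F[x].* xⁿ-1) x + Λ v x      ≈⟨ Λ-+ˡ (s F[x].* xⁿ-1) v x ⟨
      Λ (s F[x].* xⁿ-1 F[x].+ v) x     ≈⟨ Λ-congˡ u _ u≋ ⟨
      Λ u x                            ≈⟨ Λu≈0 x ⟩
      0#                               ∎

  Λ-difference : ∀ u {x y} → Λ u x ≈ Λ u y → Λ u (x - y) ≈ 0#
  Λ-difference u {x} {y} eq = +-identityˡ-unique _ (Λ u y) (begin
    Λ u (x - y) + Λ u y  ≈⟨ Λ-+ u (x - y) y ⟨
    Λ u (x - y + y)      ≈⟨ Λ-cong u (trans (+-assoc x _ y) (trans (+-congˡ (-‿inverseˡ y)) (+-identityʳ x))) ⟩
    Λ u x                ≈⟨ eq ⟩
    Λ u y                ∎)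

  Λ-injective : ∀ u → (∀ x → Λ u x ≈ 0# → x ≈ 0#) → ∀ {x y} → Λ u x ≈ Λ u y → x ≈ y
  Λ-injective u kernel {x} {y} eq = x∙y⁻¹≈ε⇒x≈y x y (kernel (x - y) (Λ-difference u eq))

  -- If w d = xⁿ - 1 and Λ d is injective, hence surjective, then Λ w = 0; so w is a multiple of xⁿ - 1.
  injective-divisor⇒unit : ∀ d w → w F[x].* d ≋ᶠ xⁿ-1 → (∀ x → Λ d x ≈ 0# → x ≈ 0#) →
    ∃ λ s → s F[x].* d ≋ᶠ F[x].1#
  injective-divisor⇒unit d w wd≋ kernel =
    let s , w≋ = Λ≈0⇒xⁿ-1∣ w Λw≈0 in s , cofactor-unit xⁿ-1-degree {s} wd≋ w≋
    where
    Λw≈0 : ∀ x → Λ w x ≈ 0#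
    Λw≈0 x with y , Λdy≈x ← KF.injective⇒surjective (Λ-cong d) (Λ-injective d kernel) x = begin
      Λ w x             ≈⟨ Λ-cong w Λdy≈x ⟨
      Λ w (Λ d y)       ≈⟨ Λ-* w d y ⟨
      Λ (w F[x].* d) y  ≈⟨ Λ-congˡ (w F[x].* d) _ wd≋ ⟩
      Λ xⁿ-1 y          ≈⟨ Λ-xⁿ-1 y ⟩
      0#                ∎

  -- The eigenspace δ𝔽_q and the image of `G`.

  module Eigenspace (a : F.Carrier) (aⁿ≈1 : a F.^ n F.≈ F.1#)
    (δ : K.Carrier) (δ#0 : δ K.# K.0#) (δ-eigen : δ K.^ q K.≈ ι a K.* δ) where

    δ≉0 : ¬ δ ≈ 0#
    δ≉0 = KF.#⇒≉ δ#0

    a≉0 : ¬ a F.≈ F.0#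
    a≉0 a≈0 = FF.nontrivial 1<q (F-ring.trans (F-ring.sym aⁿ≈1) (0^ 0<n))
      where
      0^ : ∀ {m} → 0 ℕ.< m → a F.^ m F.≈ F.0#
      0^ (s≤s _) = F-ring.trans (F-ring.*-congʳ a≈0) (F-ring.zeroˡ _)

    ιa⁻¹ : ι a K.⁻¹ * ι a ≈ 1#
    ιa⁻¹ = KF.⁻¹-inverseˡ (KF.≉⇒# (ι-≉0 a≉0))

    G : Carrier → Carrier
    G = Λ (g a)

    G-cong : ∀ {x y} → x ≈ y → G x ≈ G y
    G-cong = Λ-cong (g a)

    [x-a]g≋xⁿ-1 : (F[x].X F[x].- F[x].C a) F[x].* g a ≋ᶠ xⁿ-1
    [x-a]g≋xⁿ-1 = Fᵖ.pointwise (quotient-correct F.commutativeRing n aⁿ≈1)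

    quotient-below : ∀ m i → m ℕ.≤ i → F[x].coeff (F[x].quotient m a) i F.≈ F.0#
    quotient-below zero    i       m≤i       = F-ring.refl
    quotient-below (suc m) (suc i) (s≤s m≤i) = quotient-below m i m≤i

    quotient-lead : ∀ m → F[x].coeff (F[x].quotient (suc m) a) m F.≈ F.1#
    quotient-lead zero    = F-ring.refl
    quotient-lead (suc m) = quotient-lead m

    g-degree : HasDegree (n ℕ.∸ 1) (g a)
    g-degree = go 0<n
      where
      go : ∀ {m} → 0 ℕ.< m → HasDegree (m ℕ.∸ 1) (F[x].quotient m a)
      go {suc m} _ = record
        { below = quotient-below (suc m) ; lead⁻¹ = F.1#
        ; lead⁻¹*lead = F-ring.trans (F-ring.*-identityˡ _) (quotient-lead m) }

    g≇0 : ¬ g a ≋ᶠ []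
    g≇0 = go 0<n
      where
      go : ∀ {m} → 0 ℕ.< m → ¬ F[x].quotient m a ≋ᶠ []
      go {suc m} _ eq = FF.nontrivial 1<q (F-ring.trans (F-ring.sym (quotient-lead m)) (Fᵖ.at eq m))

    -- At a, each of the n terms of g_a equals a^(n-1), and the factor a completes it to aⁿ = 1.
    a*g[a]≈n·1 : a F.* F[x].eval (g a) a F.≈ n F.· F.1#
    a*g[a]≈n·1 = F-ring.trans (go n) (F-mult.×-congʳ n aⁿ≈1)
      where
      go : ∀ m → a F.* F[x].eval (F[x].quotient m a) a F.≈ m F.· (a F.^ m)
      go zero    = F-ring.zeroʳ a
      go (suc m) = F-ring.trans (F-ring.distribˡ a _ _) (F-ring.+-congˡ
        (F-ring.trans (F-ring.*-congˡ (go m)) (F-mult.×-comm-* m a _)))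

    Eigen : Carrier → Set ℓ₂
    Eigen y = σ y ≈ ι a * y

    G-eigen : ∀ x → Eigen (G x)
    G-eigen x = x∙y⁻¹≈ε⇒x≈y _ _ (begin
      σ y - ι a * y
        ≈⟨ +-comm _ _ ⟩
      - (ι a * y) + σ y
        ≈⟨ +-cong (trans (-‿distribˡ-* _ y) (*-congʳ (sym (trans (ι-cong (F-ring.+-identityˡ _)) (ι-neg a)))))
                  (sym (Λ-1 (σ y))) ⟩
      Λ (F[x].X F[x].- F[x].C a) y
        ≈⟨ Λ-* (F[x].X F[x].- F[x].C a) (g a) x ⟨
      Λ ((F[x].X F[x].- F[x].C a) F[x].* g a) x
        ≈⟨ Λ-congˡ ((F[x].X F[x].- F[x].C a) F[x].* g a) _ [x-a]g≋xⁿ-1 ⟩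
      Λ xⁿ-1 x
        ≈⟨ Λ-xⁿ-1 x ⟩
      0# ∎)
      where y = G x

    Λ-eigen : ∀ u {y} → Eigen y → Λ u y ≈ ι (F[x].eval u a) * y
    Λ-eigen []      {y} eigen = sym (trans (*-congʳ ι-0) (zeroˡ y))
    Λ-eigen (c ∷ u) {y} eigen = begin
      ι c * y + Λ u (σ y)                   ≈⟨ +-congˡ (trans (Λ-cong u eigen) (Λ-ι* u a y)) ⟩
      ι c * y + ι a * Λ u y                 ≈⟨ +-congˡ (*-congˡ (Λ-eigen u eigen)) ⟩
      ι c * y + ι a * (ι (F[x].eval u a) * y)
        ≈⟨ solve 4 (λ c a e y → (c :* y :+ a :* (e :* y)) := ((c :+ a :* e) :* y)) refl _ _ _ y ⟩
      (ι c + ι a * ι (F[x].eval u a)) * y   ≈⟨ *-congʳ (trans (ι-+ c _) (+-congˡ (ι-* a _))) ⟨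
      ι (c F.+ a F.* F[x].eval u a) * y     ∎

    δι-eigen : ∀ t → Eigen (δ * ι t)
    δι-eigen t = begin
      σ (δ * ι t)        ≈⟨ σ-* δ (ι t) ⟩
      σ δ * σ (ι t)      ≈⟨ *-cong δ-eigen (σ-ι t) ⟩
      ι a * δ * ι t      ≈⟨ *-assoc _ _ _ ⟩
      ι a * (δ * ι t)    ∎

    -- σ multiplies both y and δ by a, so y/δ is fixed by σ and lies in 𝔽_q.
    eigen⇒δι : ∀ {y} → Eigen y → ∃ λ t → y ≈ δ * ι t
    eigen⇒δι {y} eigen = let t , ιt≈z = fixed⇒ι σz≈z in t , sym (trans (*-congˡ ιt≈z) δz≈y)
      where
      z = δ K.⁻¹ * y

      δz≈y : δ * z ≈ y
      δz≈y = trans (sym (*-assoc δ _ y)) (trans (*-congʳ (K.⁻¹-inverseʳ δ#0)) (*-identityˡ y))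

      σz≈z : σ z ≈ z
      σz≈z = KF.*-cancelˡ (KF.*-≉0 (ι-≉0 a≉0) δ≉0) (begin
        ι a * δ * σ z   ≈⟨ *-congʳ δ-eigen ⟨
        σ δ * σ z       ≈⟨ σ-* δ z ⟨
        σ (δ * z)       ≈⟨ σ-cong δz≈y ⟩
        σ y             ≈⟨ eigen ⟩
        ι a * y         ≈⟨ *-congˡ δz≈y ⟨
        ι a * (δ * z)   ≈⟨ *-assoc _ _ _ ⟨
        ι a * δ * z     ∎)

    coordinate : ∀ x → ∃ λ t → G x ≈ δ * ι t
    coordinate x = eigen⇒δι (G-eigen x)

    -- Linear independence excludes G = 0, because g_a is nonzero of degree below n. One nonzero
    -- value δ t₀ suffices: the image is closed under 𝔽_q-multiples, and t / t₀ scales it to δ t.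
    G-onto : ∀ t → ∃ λ x → G x ≈ δ * ι t
    G-onto t with KF.any? (λ x≈y Gx≉0 Gy≈0 → Gx≉0 (trans (G-cong x≈y) Gy≈0)) (λ x → ¬? (KF.≈0? (G x)))
    ... | no G≈0 = contradiction (Λ-independent (g a) (quotient-below n) λ x →
      decidable-stable (KF.≈0? (G x)) λ Gx≉0 → G≈0 (x , Gx≉0)) g≇0
    ... | yes (x₀ , Gx₀≉0) = ι s * x₀ , (begin
        G (ι s * x₀)               ≈⟨ Λ-ι* (g a) s x₀ ⟩
        ι s * G x₀                 ≈⟨ *-congˡ Gx₀≈ ⟩
        ι s * (δ * ι t₀)           ≈⟨ solve 3 (λ s d t → (s :* (d :* t)) := (d :* (s :* t))) refl _ _ _ ⟩
        δ * (ι s * ι t₀)           ≈⟨ *-congˡ (ι-* s t₀) ⟨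
        δ * ι (t F.* t₀ F.⁻¹ F.* t₀) ≈⟨ *-congˡ (ι-cong (F-ring.trans (F-ring.*-assoc t _ t₀)
                                         (F-ring.trans (F-ring.*-congˡ (FF.⁻¹-inverseˡ (FF.≉⇒# t₀≉0))) (F-ring.*-identityʳ t)))) ⟩
        δ * ι t                    ∎)
      where
      t₀    = proj₁ (coordinate x₀)
      Gx₀≈  = proj₂ (coordinate x₀)
      s     = t F.* t₀ F.⁻¹
      t₀≉0 : ¬ t₀ F.≈ F.0#
      t₀≉0 t₀≈0 = Gx₀≉0 (trans Gx₀≈ (trans (*-congˡ (trans (ι-cong t₀≈0) ι-0)) (zeroʳ δ)))

    -- The source of the trace in `Q̄`. As σⁱ(δ w) = aⁱ δ w^(qⁱ) and the i-th coefficient of g_a is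
    -- a^(n-1-i), every term carries the same a^(n-1), which the extra factor a completes to aⁿ = 1.
    a*G[δw]≈δTr : ∀ w → ι a * G (δ * w) ≈ δ * Tr w
    a*G[δw]≈δTr w = begin
      ι a * G (δ * w)            ≈⟨ go n w ⟩
      ι (a F.^ n) * (δ * Tr w)   ≈⟨ trans (*-congʳ (trans (ι-cong aⁿ≈1) ι-1)) (*-identityˡ _) ⟩
      δ * Tr w                   ∎
      where
      partialTr : ℕ → Carrier → Carrier
      partialTr m w = sum {m} λ i → w ^ (q ℕ.^ toℕ i)

      -- The induction passes through shorter quotients and partial traces, for which the common
      -- factor `a ^ m` is not yet known to be 1.
      go : ∀ m w → ι a * Λ (F[x].quotient m a) (δ * w) ≈ ι (a F.^ m) * (δ * partialTr m w)
      go zero    w = trans (zeroʳ _) (sym (trans (*-congˡ (zeroʳ δ)) (zeroʳ _)))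
      go (suc m) w = begin
        ι a * (ι (a F.^ m) * (δ * w) + Λ u (σ (δ * w)))
          ≈⟨ *-congˡ (+-congˡ (Λ-cong u (trans (σ-* δ w) (trans (*-congʳ δ-eigen) (*-assoc _ _ _))))) ⟩
        ι a * (ι (a F.^ m) * (δ * w) + Λ u (ι a * (δ * σ w)))
          ≈⟨ *-congˡ (+-congˡ (trans (Λ-ι* u a _) (go m (σ w)))) ⟩
        ι a * (ι (a F.^ m) * (δ * w) + ι (a F.^ m) * (δ * partialTr m (σ w)))
          ≈⟨ solve 5 (λ a b d w t → (a :* (b :* (d :* w) :+ b :* (d :* t))) := ((a :* b) :* (d :* (w :+ t)))) refl _ _ δ w _ ⟩
        (ι a * ι (a F.^ m)) * (δ * (w + partialTr m (σ w)))
          ≈⟨ *-cong (ι-* a (a F.^ m)) (*-congˡ (+-cong (*-identityʳ w) (sum-cong-≋ {m} λ i → ^q^suc w (toℕ i)))) ⟨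
        ι (a F.^ suc m) * (δ * partialTr (suc m) w) ∎
        where u = F[x].quotient m a


    -- Coprimality as injectivity on the kernel of `G`.

    kernel-injective : F[x].Poly → Set (c₂ ⊔ ℓ₂)
    kernel-injective h = ∀ x → G x ≈ 0# → Λ h x ≈ 0# → x ≈ 0#

    bézout⇒kernel-injective : ∀ {h s t} → s F[x].* h F[x].+ t F[x].* g a ≋ᶠ F[x].1# → kernel-injective h
    bézout⇒kernel-injective {h} {s} {t} bézout x Gx≈0 Λhx≈0 = begin
      x                                                ≈⟨ Λ-1 x ⟨
      Λ F[x].1# x                                      ≈⟨ Λ-congˡ (s F[x].* h F[x].+ t F[x].* g a) F[x].1# bézout ⟨
      Λ (s F[x].* h F[x].+ t F[x].* g a) x             ≈⟨ Λ-+ˡ (s F[x].* h) (t F[x].* g a) x ⟩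
      Λ (s F[x].* h) x + Λ (t F[x].* g a) x            ≈⟨ +-cong (Λ-*-0 s h Λhx≈0) (Λ-*-0 t (g a) Gx≈0) ⟩
      0# + 0#                                          ≈⟨ +-identityˡ 0# ⟩
      0#                                               ∎

    divisor-kernel : ∀ {z u} → z F[x].∣ u → ∀ {x} → Λ z x ≈ 0# → Λ u x ≈ 0#
    divisor-kernel {z} {u} (s , sz≈u) Λzx≈0 =
      trans (sym (Λ-congˡ (s F[x].* z) u (Fᵖ.pointwise sz≈u))) (Λ-*-0 s z Λzx≈0)

    divisor-of-g : ∀ {z} → z F[x].∣ g a → z F[x].∣ xⁿ-1
    divisor-of-g {z} (t , tz≈g) = (F[x].X F[x].- F[x].C a) F[x].* t , Fᵖ.at (F[x]ᴿ.trans
      (F[x]ᴿ.*-assoc (F[x].X F[x].- F[x].C a) t z) (F[x]ᴿ.trans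
      (F[x]ᴿ.*-congˡ {F[x].X F[x].- F[x].C a} (Fᵖ.pointwise tz≈g)) [x-a]g≋xⁿ-1))

    unit-divisor : ∀ {z} → z F[x].∣ xⁿ-1 → (∀ x → Λ z x ≈ 0# → x ≈ 0#) → z F[x].∣ F[x].1#
    unit-divisor {z} (w , wz≈) z-inj =
      let s , sz≋1 = injective-divisor⇒unit z w (Fᵖ.pointwise wz≈) z-inj in s , Fᵖ.at sz≋1

    kernel-injective⇒coprime : ∀ {h} → kernel-injective h → F[x].Coprime h (g a)
    kernel-injective⇒coprime ker z∣h z∣g = unit-divisor (divisor-of-g z∣g)
      λ x Λzx≈0 → ker x (divisor-kernel z∣g Λzx≈0) (divisor-kernel z∣h Λzx≈0)

    coprime-g⇒bézout : ∀ {h} → F[x].Coprime h (g a) → ∃₂ λ s t → s F[x].* h F[x].+ t F[x].* g a ≋ᶠ F[x].1#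
    coprime-g⇒bézout = coprime⇒bézout FF.≈0? FF.inverse (quotient-below n)

    coprime⇒kernel-injective : ∀ {h} → F[x].Coprime h (g a) → kernel-injective h
    coprime⇒kernel-injective coprime =
      let s , t , bézout = coprime-g⇒bézout coprime in bézout⇒kernel-injective {s = s} {t} bézout

    -- As p ∣ n, G vanishes on the a-eigenspace of σ, which contains the image of G.
    coprime-g⇔coprime-xⁿ-1 : p ℕ∣.∣ n → ∀ h → F[x].Coprime h (g a) ⇔ F[x].Coprime h xⁿ-1
    coprime-g⇔coprime-xⁿ-1 p∣n h = mk⇔ to from
      where
      g[a]≈0 : F[x].eval (g a) a F.≈ F.0#
      g[a]≈0 = FF.integral (F-ring.trans a*g[a]≈n·1 (p∣n⇒n·1≈0 p∣n)) a≉0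

      GG≈0 : ∀ x → G (G x) ≈ 0#
      GG≈0 x = trans (Λ-eigen (g a) (G-eigen x)) (trans (*-congʳ (trans (ι-cong g[a]≈0) ι-0)) (zeroˡ _))

      Λh-injective : F[x].Coprime h (g a) → ∀ x → Λ h x ≈ 0# → x ≈ 0#
      Λh-injective coprime x Λhx≈0 = ker x
        (ker (G x) (GG≈0 x) (trans (Λ-*-comm h (g a) x) (trans (G-cong Λhx≈0) (Λ-0 (g a))))) Λhx≈0
        where ker = coprime⇒kernel-injective coprime

      to : F[x].Coprime h (g a) → F[x].Coprime h xⁿ-1
      to coprime z∣h z∣xⁿ-1 = unit-divisor z∣xⁿ-1 λ x Λzx≈0 → Λh-injective coprime x (divisor-kernel z∣h Λzx≈0)

      from : F[x].Coprime h xⁿ-1 → F[x].Coprime h (g a)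
      from coprime z∣h z∣g = coprime z∣h (divisor-of-g z∣g)

    -- The permutation criterion.

    module _ (f : K[x].Poly) (h : F[x].Poly) (k : K[x].Poly)
      (k-unit : ∀ y → ∃ λ z → z F.# F.0# × K[x].eval k (δ K.* ι y) K.≈ ι z) where

      private
        κ : F.Carrier → F.Carrier
        κ t = proj₁ (k-unit t)

        κ≉0 : ∀ t → ¬ ι (κ t) ≈ 0#
        κ≉0 t = ι-≉0 (FF.#⇒≉ (proj₁ (proj₂ (k-unit t))))

        k≈κ : ∀ t → eval k (δ * ι t) ≈ ι (κ t)
        k≈κ t = proj₂ (proj₂ (k-unit t))

        Pᵉ = eval (P a f h k)
        Q̄ᵉ = eval (Q̄ a δ f h k)

      eval-P : ∀ x → Pᵉ x ≈ eval f (G x) + eval k (G x) * Λ h x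
      eval-P x = trans (eval-+ (f K[x].∘ L (g a)) ((k K[x].∘ L (g a)) K[x].* L h) x) (+-cong
        (trans (eval-∘ f (L (g a)) x) (eval-congʳ f (eval-L (g a) x)))
        (trans (eval-* (k K[x].∘ L (g a)) (L h) x) (*-cong
          (trans (eval-∘ k (L (g a)) x) (eval-congʳ k (eval-L (g a) x))) (eval-L h x))))

      eval-P-at : ∀ {x t} → G x ≈ δ * ι t → Pᵉ x ≈ eval f (δ * ι t) + ι (κ t) * Λ h x
      eval-P-at {x} {t} Gx≈ = trans (eval-P x)
        (+-cong (eval-congʳ f Gx≈) (*-congʳ (trans (eval-congʳ k Gx≈) (k≈κ t))))

      Tr-cong : ∀ {x y} → x ≈ y → Tr x ≈ Tr y
      Tr-cong x≈y = sum-cong-≋ {n} λ i → ^-congˡ (q ℕ.^ toℕ i) x≈y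

      -- The weight m is δ⁻¹ in `Q̄`. It is a parameter because passing to the tail of f multiplies
      -- it by δ.
      trace-sum : (f : K[x].Poly) (m : Carrier) → Carrier → Carrier
      trace-sum f m x = sum {length f} λ i → Tr (δ ^ toℕ i * m * lookup f i) * x ^ toℕ i

      -- Horner's scheme for f(δ t): the factor t lies in 𝔽_q and leaves G by linearity, and each
      -- coefficient is handled by the trace formula.
      a*G-trace-sum : ∀ f m t → ι a * G (δ * (m * eval f (δ * ι t))) ≈ δ * trace-sum f m (ι t)
      a*G-trace-sum []      m t = trans
        (*-congˡ (trans (G-cong (trans (*-congˡ (zeroʳ m)) (zeroʳ δ))) (Λ-0 (g a))))
        (trans (zeroʳ _) (sym (zeroʳ δ)))
      a*G-trace-sum (c ∷ f) m t = begin
        ι a * G (δ * (m * (c + δ * ι t * e)))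
          ≈⟨ *-congˡ (G-cong (solve 5 (λ d m c t e → (d :* (m :* (c :+ d :* t :* e))) :=
               (d :* (m :* c) :+ t :* (d :* (m :* d :* e)))) refl δ m c (ι t) e)) ⟩
        ι a * G (δ * (m * c) + ι t * (δ * (m * δ * e)))
          ≈⟨ *-congˡ (trans (Λ-+ (g a) _ _) (+-congˡ (Λ-ι* (g a) t _))) ⟩
        ι a * (G (δ * (m * c)) + ι t * G (δ * (m * δ * e)))
          ≈⟨ solve 4 (λ a x t y → (a :* (x :+ t :* y)) := (a :* x :+ t :* (a :* y))) refl _ _ _ _ ⟩
        ι a * G (δ * (m * c)) + ι t * (ι a * G (δ * (m * δ * e)))
          ≈⟨ +-cong (a*G[δw]≈δTr (m * c)) (*-congˡ (a*G-trace-sum f (m * δ) t)) ⟩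
        δ * Tr (m * c) + ι t * (δ * trace-sum f (m * δ) (ι t))
          ≈⟨ solve 4 (λ d x t y → (d :* x :+ t :* (d :* y)) := (d :* (x :+ t :* y))) refl _ _ _ _ ⟩
        δ * (Tr (m * c) + ι t * trace-sum f (m * δ) (ι t))
          ≈⟨ *-congˡ (+-cong
               (trans (*-identityʳ _) (Tr-cong (*-congʳ (*-identityˡ m))))
               (trans (sum-cong-≋ {length f} (λ i → trans
                 (*-congʳ (Tr-cong (*-congʳ (solve 3 (λ d x m → ((d :* x) :* m) := (x :* (m :* d))) refl δ (δ ^ toℕ i) m))))
                 (solve 3 (λ x t y → (x :* (t :* y)) := (t :* (x :* y))) refl _ (ι t) _)))
                 (sym (*-distribˡ-sum (ι t) (λ i → Tr (δ ^ toℕ i * (m * δ) * lookup f i) * ι t ^ toℕ i))))) ⟨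
        δ * trace-sum (c ∷ f) m (ι t) ∎
        where e = eval f (δ * ι t)

      eval-Q̄ : ∀ x → Q̄ᵉ x ≈ ι a K.⁻¹ * trace-sum f (δ K.⁻¹) x + eval k (δ * x) * ι (F[x].eval h a) * x
      eval-Q̄ x = trans (eval-+ (K[x].C (ι a K.⁻¹) K[x].* S) (κᵖ K[x].* K[x].X) x) (+-cong
        (trans (eval-* (K[x].C (ι a K.⁻¹)) S x) (*-cong (eval-C _ x) (trans (eval-sum Sᵢ x)
          (sum-cong-≋ {length f} λ i → trans (eval-* (K[x].C (τ i)) (K[x].X K[x].^ toℕ i) x) (*-cong (eval-C (τ i) x)
            (trans (eval-^ K[x].X (toℕ i) x) (^-congˡ (toℕ i) (eval-X x))))))))
        (trans (eval-* κᵖ K[x].X x) (*-cong (trans (eval-* (k K[x].∘ δX) (K[x].C _) x)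
          (*-cong (trans (eval-∘ k δX x) (eval-congʳ k (trans (eval-* (K[x].C δ) K[x].X x) (*-cong (eval-C δ x) (eval-X x)))))
            (eval-C _ x))) (eval-X x))))
        where
        τ : Fin (length f) → Carrier
        τ i = Tr (δ ^ toℕ i * δ K.⁻¹ * lookup f i)
        Sᵢ : Fin (length f) → K[x].Poly
        Sᵢ i = K[x].C (τ i) K[x].* K[x].X K[x].^ toℕ i
        S   = K[x].sum Sᵢ
        δX  = K[x].C δ K[x].* K[x].X
        κᵖ  = (k K[x].∘ δX) K[x].* K[x].C (ι (F[x].eval h a))

      -- The trace formula concerns arguments of the form δ w, so f(δ t) is written as δ (δ⁻¹ f(δ
      -- t)); this explains the exponent i - 1 in `Q̄`, and the factor 1/a there undoes the a of the
      -- formula.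
      G∘f≈δ*trace-sum : ∀ t → G (eval f (δ * ι t)) ≈ δ * (ι a K.⁻¹ * trace-sum f (δ K.⁻¹) (ι t))
      G∘f≈δ*trace-sum t = begin
        G y                                         ≈⟨ trans (*-congʳ ιa⁻¹) (*-identityˡ _) ⟨
        ι a K.⁻¹ * ι a * G y                        ≈⟨ *-assoc _ _ _ ⟩
        ι a K.⁻¹ * (ι a * G y)                      ≈⟨ *-congˡ (*-congˡ (G-cong δδ⁻¹y≈y)) ⟨
        ι a K.⁻¹ * (ι a * G (δ * (δ K.⁻¹ * y)))     ≈⟨ *-congˡ (a*G-trace-sum f (δ K.⁻¹) t) ⟩
        ι a K.⁻¹ * (δ * trace-sum f (δ K.⁻¹) (ι t)) ≈⟨ solve 3 (λ a d s → (a :* (d :* s)) := (d :* (a :* s))) refl _ _ _ ⟩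
        δ * (ι a K.⁻¹ * trace-sum f (δ K.⁻¹) (ι t)) ∎
        where
        y = eval f (δ * ι t)
        δδ⁻¹y≈y : δ * (δ K.⁻¹ * y) ≈ y
        δδ⁻¹y≈y = trans (sym (*-assoc δ _ y)) (trans (*-congʳ (K.⁻¹-inverseʳ δ#0)) (*-identityˡ y))

      -- The value `κ t` of k lies in 𝔽_q and passes through G; G commutes with `Λ h`, which acts on
      -- the eigenvector G x as h(a).
      G∘P≈δ*Q̄ : ∀ {x t} → G x ≈ δ * ι t → G (Pᵉ x) ≈ δ * Q̄ᵉ (ι t)
      G∘P≈δ*Q̄ {x} {t} Gx≈ = begin
        G (Pᵉ x)
          ≈⟨ G-cong (eval-P-at Gx≈) ⟩
        G (eval f (δ * ι t) + ι (κ t) * Λ h x)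
          ≈⟨ trans (Λ-+ (g a) _ _) (+-cong (G∘f≈δ*trace-sum t) (Λ-ι* (g a) (κ t) (Λ h x))) ⟩
        δ * T + ι (κ t) * G (Λ h x)
          ≈⟨ +-congˡ (*-congˡ (trans (Λ-*-comm (g a) h x) (trans (Λ-cong h Gx≈) (Λ-eigen h (δι-eigen t))))) ⟩
        δ * T + ι (κ t) * (ι (F[x].eval h a) * (δ * ι t))
          ≈⟨ solve 5 (λ d T k h t → (d :* T :+ k :* (h :* (d :* t))) := (d :* (T :+ k :* h :* t))) refl δ T _ _ (ι t) ⟩
        δ * (T + ι (κ t) * ι (F[x].eval h a) * ι t)
          ≈⟨ *-congˡ (+-congˡ (*-congʳ (*-congʳ (k≈κ t)))) ⟨
        δ * (T + eval k (δ * ι t) * ι (F[x].eval h a) * ι t)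
          ≈⟨ *-congˡ (eval-Q̄ (ι t)) ⟨
        δ * Q̄ᵉ (ι t) ∎
        where T = ι a K.⁻¹ * trace-sum f (δ K.⁻¹) (ι t)

      -- `Q̄` has coefficients in the large field, so a map on 𝔽_q has to be produced: t is lifted
      -- to some x with G x = δ t, and the coordinate of G (P x) is taken.
      φ : F.Carrier → F.Carrier
      φ t = proj₁ (coordinate (Pᵉ (proj₁ (G-onto t))))

      φ-induced : InducesOnF (Q̄ a δ f h k) φ
      φ-induced t = KF.*-cancelˡ δ≉0 (trans (sym (G∘P≈δ*Q̄ (proj₂ (G-onto t)))) (proj₂ (coordinate _)))

      module _ {φ : F.Carrier → F.Carrier} (Q̄≈φ : InducesOnF (Q̄ a δ f h k) φ) where

        -- `InducesOnF` does not ask that φ respect equality; this is inherited from evaluation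
        -- because ι is injective.
        induced-cong : Congruent F._≈_ F._≈_ φ
        induced-cong {s} {t} s≈t = ι-injective (begin
          ι (φ s)      ≈⟨ Q̄≈φ s ⟨
          Q̄ᵉ (ι s)     ≈⟨ eval-congʳ (Q̄ a δ f h k) (ι-cong s≈t) ⟩
          Q̄ᵉ (ι t)     ≈⟨ Q̄≈φ t ⟩
          ι (φ t)      ∎)

        G∘P≈δφ : ∀ {x t} → G x ≈ δ * ι t → G (Pᵉ x) ≈ δ * ι (φ t)
        G∘P≈δφ {t = t} Gx≈ = trans (G∘P≈δ*Q̄ Gx≈) (*-congˡ (Q̄≈φ t))

        -- Applying G to P x = P y gives equal coordinates, as φ is injective. Then the values of f
        -- and of k agree as well, and since that of k is nonzero, `Λ h` identifies x and y. Hence x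
        -- - y is killed by both G and `Λ h`.
        P-injective : kernel-injective h → Injective F._≈_ F._≈_ φ → Injective _≈_ _≈_ Pᵉ
        P-injective ker φ-inj {x} {y} Px≈Py = x∙y⁻¹≈ε⇒x≈y x y
          (ker (x - y) (Λ-difference (g a) Gx≈Gy) (Λ-difference h Λhx≈Λhy))
          where
          s    = proj₁ (coordinate x)
          Gx≈  = proj₂ (coordinate x)
          t    = proj₁ (coordinate y)
          Gy≈  = proj₂ (coordinate y)

          s≈t : s F.≈ t
          s≈t = φ-inj (ι-injective (KF.*-cancelˡ δ≉0 (begin
            δ * ι (φ s)   ≈⟨ G∘P≈δφ Gx≈ ⟨
            G (Pᵉ x)      ≈⟨ G-cong Px≈Py ⟩
            G (Pᵉ y)      ≈⟨ G∘P≈δφ Gy≈ ⟩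
            δ * ι (φ t)   ∎)))

          Gx≈Gy : G x ≈ G y
          Gx≈Gy = trans Gx≈ (trans (*-congˡ (ι-cong s≈t)) (sym Gy≈))

          Λhx≈Λhy : Λ h x ≈ Λ h y
          Λhx≈Λhy = KF.*-cancelˡ (κ≉0 t) (+-cancelˡ (eval f (δ * ι t)) _ _ (begin
            eval f (δ * ι t) + ι (κ t) * Λ h x  ≈⟨ eval-P-at (trans Gx≈Gy Gy≈) ⟨
            Pᵉ x                                ≈⟨ Px≈Py ⟩
            Pᵉ y                                ≈⟨ eval-P-at Gy≈ ⟩
            eval f (δ * ι t) + ι (κ t) * Λ h y  ∎))

      Pᵉ-cong : Congruent _≈_ _≈_ Pᵉ
      Pᵉ-cong = eval-congʳ (P a f h k)

      -- An element killed by both G and `Λ h` has the same image under P as 0.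
      P-permutation⇒coprime : IsPermutationPolynomial (P a f h k) → F[x].Coprime h (g a)
      P-permutation⇒coprime (P-inj , _) = kernel-injective⇒coprime λ x Gx≈0 Λhx≈0 → P-inj (begin
        Pᵉ x                                    ≈⟨ eval-P x ⟩
        eval f (G x) + eval k (G x) * Λ h x     ≈⟨ +-cong (eval-congʳ f (Gx≈G0 Gx≈0))
                                                     (*-cong (eval-congʳ k (Gx≈G0 Gx≈0)) (trans Λhx≈0 (sym (Λ-0 h)))) ⟩
        eval f (G 0#) + eval k (G 0#) * Λ h 0#  ≈⟨ eval-P 0# ⟨
        Pᵉ 0#                                   ∎)
        where
        Gx≈G0 : ∀ {x} → G x ≈ 0# → G x ≈ G 0#
        Gx≈G0 Gx≈0 = trans Gx≈0 (sym (Λ-0 (g a)))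

      -- Surjectivity is the property that passes through G: both P and G onto the eigenspace are
      -- surjective. Finiteness of 𝔽_q then gives injectivity of φ.
      φ-surjective : IsPermutationPolynomial (P a f h k) → StrictlySurjective F._≈_ φ
      φ-surjective (_ , P-surj) s =
        let y , Gy≈ = G-onto s
            x , Px≈y = P-surj y
            t , Gx≈ = coordinate x
        in t , ι-injective (KF.*-cancelˡ δ≉0 (begin
          δ * ι (φ t)  ≈⟨ G∘P≈δφ φ-induced Gx≈ ⟨
          G (Pᵉ x)     ≈⟨ G-cong (Px≈y refl) ⟩
          G y          ≈⟨ Gy≈ ⟩
          δ * ι s      ∎))

      permutation-criterion : IsPermutationPolynomial (P a f h k) ⇔
        (F[x].Coprime h (g a) × InducesPermutationOfF (Q̄ a δ f h k))
      permutation-criterion = mk⇔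
        (λ P-perm → P-permutation⇒coprime P-perm , φ , φ-induced ,
          FF.surjective⇒injective (induced-cong φ-induced) (φ-surjective P-perm) ,
          λ s → let t , φt≈s = φ-surjective P-perm s
                in t , λ z≈t → F-ring.trans (induced-cong φ-induced z≈t) φt≈s)
        (λ (coprime , φ , Q̄≈φ , φ-inj , _) →
          let P-inj = P-injective Q̄≈φ (coprime⇒kernel-injective coprime) φ-inj
          in P-inj , λ y → let x , Px≈y = KF.injective⇒surjective Pᵉ-cong P-inj y
                           in x , λ z≈x → trans (Pᵉ-cong z≈x) Px≈y)

      -- The inverse permutation.

      module _ (R : K[x].Poly) (H : F[x].Poly) (F : K[x].Poly) where

        private
          Rᵉ  = eval R
          P₀ᵉ = eval (P₀ a δ k H F R)

          κ⁻¹ : F.Carrier → Carrier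
          κ⁻¹ t = ι (κ t) ^ (q ℕ.∸ 2)

          κ⁻¹*κ≈1 : ∀ t → κ⁻¹ t * ι (κ t) ≈ 1#
          κ⁻¹*κ≈1 t = begin
            ι (κ t) ^ (q ℕ.∸ 2) * ι (κ t)         ≈⟨ *-comm _ _ ⟩
            ι (κ t) * ι (κ t) ^ (q ℕ.∸ 2)         ≈⟨ *-congˡ (ι-^ (κ t) (q ℕ.∸ 2)) ⟨
            ι (κ t) * ι (κ t F.^ (q ℕ.∸ 2))       ≈⟨ ι-* (κ t) _ ⟨
            ι (κ t F.* κ t F.^ (q ℕ.∸ 2))         ≈⟨ ι-cong (FF.x^[N-1]≈1 1<q (FF.#⇒≉ (proj₁ (proj₂ (k-unit t))))) ⟩
            ι F.1#                                ≈⟨ ι-1 ⟩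
            1#                                    ∎

          δR : K[x].Poly
          δR = K[x].C δ K[x].* R

          eval-δR : ∀ x → eval δR x ≈ δ * Rᵉ x
          eval-δR x = trans (eval-* (K[x].C δ) R x) (*-congʳ (eval-C δ x))

        eval-P₀ : ∀ x → P₀ᵉ x ≈ eval F (δ K.⁻¹ * G x) + eval k (δ * Rᵉ (δ K.⁻¹ * G x)) ^ (q ℕ.∸ 2) * Λ H x
        eval-P₀ x = trans (eval-+ (F K[x].∘ y) (kRy K[x].^ (q ℕ.∸ 2) K[x].* L H) x) (+-cong
          (trans (eval-∘ F y x) (eval-congʳ F eval-y))
          (trans (eval-* (kRy K[x].^ (q ℕ.∸ 2)) (L H) x) (*-cong
            (trans (eval-^ kRy (q ℕ.∸ 2) x) (^-congˡ (q ℕ.∸ 2) (trans (eval-∘ k (K[x].C δ K[x].* (R K[x].∘ y)) x)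
              (eval-congʳ k (trans (eval-* (K[x].C δ) (R K[x].∘ y) x) (*-cong (eval-C δ x)
                (trans (eval-∘ R y x) (eval-congʳ R eval-y))))))))
            (eval-L H x))))
          where
          y   = K[x].C (δ K.⁻¹) K[x].* L (g a)
          kRy = k K[x].∘ (K[x].C δ K[x].* (R K[x].∘ y))
          eval-y : eval y x ≈ δ K.⁻¹ * G x
          eval-y = trans (eval-* (K[x].C (δ K.⁻¹)) (L (g a)) x) (*-cong (eval-C _ x) (eval-L (g a) x))

        module _ {φ ψ : F.Carrier → F.Carrier} (Q̄≈φ : InducesOnF (Q̄ a δ f h k) φ) (R≈ψ : InducesOnF R ψ)
          (φψ-inverse : Inverseᵇ F._≈_ F._≈_ φ ψ) where

          private
            B : F.Carrier → Carrier
            B t = κ⁻¹ t * Λ H (eval f (δ * ι t))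

          R∘φ : ∀ t → Rᵉ (ι (φ t)) ≈ ι t
          R∘φ t = trans (R≈ψ (φ t)) (ι-cong (proj₂ φψ-inverse F-ring.refl))

          eval-δR-φ : ∀ t → eval δR (ι (φ t)) ≈ δ * ι t
          eval-δR-φ t = trans (eval-δR _) (*-congˡ (R∘φ t))

          -- From P x the polynomial `P₀` reads off the coordinate φ t, and R turns it back into t.
          -- So k is evaluated at the same point δ t as in P, and its power q - 2 cancels it. The
          -- summand `B t` is left for F to remove.
          P₀∘P : ∀ {x t} → G x ≈ δ * ι t → P₀ᵉ (Pᵉ x) ≈ eval F (ι (φ t)) + B t + Λ (h F[x].* H) x
          P₀∘P {x} {t} Gx≈ = begin
            P₀ᵉ (Pᵉ x)
              ≈⟨ eval-P₀ (Pᵉ x) ⟩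
            eval F y + eval k (δ * Rᵉ y) ^ (q ℕ.∸ 2) * Λ H (Pᵉ x)
              ≈⟨ +-cong (eval-congʳ F y≈) (*-cong
                   (^-congˡ (q ℕ.∸ 2) (trans (eval-congʳ k (*-congˡ (trans (eval-congʳ R y≈) (R∘φ t)))) (k≈κ t)))
                   (trans (Λ-cong H (eval-P-at Gx≈)) (trans (Λ-+ H _ _) (+-congˡ (trans (Λ-ι* H (κ t) _)
                     (*-congˡ (trans (sym (Λ-* H h x)) (Λ-congˡ (H F[x].* h) (h F[x].* H) (F[x]ᴿ.*-comm H h))))))))) ⟩
            eval F (ι (φ t)) + κ⁻¹ t * (Λ H (eval f (δ * ι t)) + ι (κ t) * Λ (h F[x].* H) x)
              ≈⟨ solve 5 (λ F k′ k b x → (F :+ k′ :* (b :+ k :* x)) := (F :+ k′ :* b :+ k′ :* k :* x)) refl _ _ _ _ _ ⟩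
            eval F (ι (φ t)) + B t + κ⁻¹ t * ι (κ t) * Λ (h F[x].* H) x
              ≈⟨ +-congˡ (trans (*-congʳ (κ⁻¹*κ≈1 t)) (*-identityˡ _)) ⟩
            eval F (ι (φ t)) + B t + Λ (h F[x].* H) x ∎
            where
            y = δ K.⁻¹ * G (Pᵉ x)
            y≈ : y ≈ ι (φ t)
            y≈ = trans (*-congˡ (G∘P≈δφ Q̄≈φ Gx≈)) (trans (sym (*-assoc _ δ _))
              (trans (*-congʳ (KF.⁻¹-inverseˡ δ#0)) (*-identityˡ _)))

          -- A left inverse of a surjection is also a right inverse.
          left-inverse⇒inverse : IsPermutationPolynomial (P a f h k) → (∀ x → P₀ᵉ (Pᵉ x) ≈ x) →
            InducesInverse (P a f h k) (P₀ a δ k H F R)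
          left-inverse⇒inverse (_ , P-surj) P₀P≈id =
            (λ {x} y≈P₀x → let x′ , Px′≈x = P-surj x in
              trans (Pᵉ-cong (trans y≈P₀x (trans (P₀ᵉ-cong (sym (Px′≈x refl))) (P₀P≈id x′)))) (Px′≈x refl)) ,
            λ {x} y≈Px → trans (P₀ᵉ-cong y≈Px) (P₀P≈id x)
            where
            P₀ᵉ-cong : Congruent _≈_ _≈_ P₀ᵉ
            P₀ᵉ-cong = eval-congʳ (P₀ a δ k H F R)

          -- X^q - X vanishes on 𝔽_q, and F is only ever evaluated there, at the coordinate δ⁻¹ G (P
          -- x).
          eval-mod-x^q-x : ∀ u v → u K[x].≡ v [mod K[x].X K[x].^ q K[x].- K[x].X ] → ∀ t → eval u (ι t) ≈ eval v (ι t)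
          eval-mod-x^q-x u v u≡v t = let e , u≋ = Kᴰ.mod-elim {u} {v} u≡v in begin
            eval u (ι t)                              ≈⟨ eval-cong u (v K[x].+ e K[x].* w) u≋ refl ⟩
            eval (v K[x].+ e K[x].* w) (ι t)          ≈⟨ trans (eval-+ v (e K[x].* w) _) (+-congˡ (eval-* e w _)) ⟩
            eval v (ι t) + eval e (ι t) * eval w (ι t) ≈⟨ +-congˡ (trans (*-congˡ w≈0) (zeroʳ _)) ⟩
            eval v (ι t) + 0#                         ≈⟨ +-identityʳ _ ⟩
            eval v (ι t)                              ∎
            where
            w = K[x].X K[x].^ q K[x].- K[x].X
            w≈0 : eval w (ι t) ≈ 0#
            w≈0 = trans (eval-+ (K[x].X K[x].^ q) (K[x].- K[x].X) (ι t)) (trans (+-cong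
              (trans (eval-^ K[x].X q (ι t)) (trans (σ-cong (eval-X (ι t))) (σ-ι t)))
              (trans (eval-neg K[x].X (ι t)) (-‿cong (eval-X (ι t))))) (-‿inverseʳ (ι t)))

          private
            eval-κ⁻¹ : ∀ u {x t} → eval u x ≈ δ * ι t → eval ((k K[x].∘ u) K[x].^ (q ℕ.∸ 2)) x ≈ κ⁻¹ t
            eval-κ⁻¹ u {x} {t} ux≈ = trans (eval-^ (k K[x].∘ u) (q ℕ.∸ 2) x)
              (^-congˡ (q ℕ.∸ 2) (trans (eval-∘ k u x) (trans (eval-congʳ k ux≈) (k≈κ t))))

            -B+B≈0 : ∀ t → - κ⁻¹ t * Λ H (eval f (δ * ι t)) + B t ≈ 0#
            -B+B≈0 t = trans (sym (distribʳ _ _ _)) (trans (*-congʳ (-‿inverseˡ _)) (zeroˡ _))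

          -- F has only `B t` to cancel. It is evaluated at φ t, where `δR` returns the point δ t at
          -- which `B t` is formed.
          inverse-case-I : IsPermutationPolynomial (P a f h k) → (h F[x].* H) F[x].≡ F[x].1# [mod xⁿ-1 ] →
            F K[x].≡ (K[x].- ((k K[x].∘ δR) K[x].^ (q ℕ.∸ 2)) K[x].* (L H K[x].∘ (f K[x].∘ δR)))
              [mod K[x].X K[x].^ q K[x].- K[x].X ] →
            InducesInverse (P a f h k) (P₀ a δ k H F R)
          inverse-case-I P-perm hH≡1 F≡ = left-inverse⇒inverse P-perm λ x →
            let t , Gx≈ = coordinate x in begin
            P₀ᵉ (Pᵉ x)                                                ≈⟨ P₀∘P Gx≈ ⟩
            eval F (ι (φ t)) + B t + Λ (h F[x].* H) x                 ≈⟨ +-cong (+-congʳ (F[φt]≈ t)) (Λ[hH]≈ x) ⟩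
            - κ⁻¹ t * Λ H (eval f (δ * ι t)) + B t + x                ≈⟨ trans (+-congʳ (-B+B≈0 t)) (+-identityˡ x) ⟩
            x                                                         ∎
            where
            F[φt]≈ : ∀ t → eval F (ι (φ t)) ≈ - κ⁻¹ t * Λ H (eval f (δ * ι t))
            F[φt]≈ t = begin
              eval F s
                ≈⟨ eval-mod-x^q-x F _ F≡ (φ t) ⟩
              eval (K[x].- kR K[x].* (L H K[x].∘ (f K[x].∘ δR))) s
                ≈⟨ eval-* (K[x].- kR) (L H K[x].∘ (f K[x].∘ δR)) s ⟩
              eval (K[x].- kR) s * eval (L H K[x].∘ (f K[x].∘ δR)) s
                ≈⟨ *-cong (trans (eval-neg kR s) (-‿cong (eval-κ⁻¹ δR (eval-δR-φ t))))
                          (trans (eval-∘ (L H) (f K[x].∘ δR) s) (trans (eval-L H _)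
                            (Λ-cong H (trans (eval-∘ f δR s) (eval-congʳ f (eval-δR-φ t)))))) ⟩
              - κ⁻¹ t * Λ H (eval f (δ * ι t)) ∎
              where
              s  = ι (φ t)
              kR = (k K[x].∘ δR) K[x].^ (q ℕ.∸ 2)

            Λ[hH]≈ : ∀ x → Λ (h F[x].* H) x ≈ x
            Λ[hH]≈ x = let e , hH≋ = Fᴰ.mod-elim {h F[x].* H} {F[x].1#} hH≡1 in begin
              Λ (h F[x].* H) x                        ≈⟨ Λ-congˡ (h F[x].* H) _ hH≋ ⟩
              Λ (F[x].1# F[x].+ e F[x].* xⁿ-1) x      ≈⟨ Λ-+ˡ F[x].1# (e F[x].* xⁿ-1) x ⟩
              Λ F[x].1# x + Λ (e F[x].* xⁿ-1) x       ≈⟨ +-cong (Λ-1 x) (Λ-*-0 e xⁿ-1 (Λ-xⁿ-1 x)) ⟩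
              x + 0#                                  ≈⟨ +-identityʳ x ⟩
              x                                       ∎

          -- Besides `B t` there is `ι e[a] * (δ * ι t)` to cancel. As `δR` takes φ t to δ t, a term
          -- of `M` linear in its argument is of the right shape.
          inverse-case-II : p ℕ∣.∤ n → IsPermutationPolynomial (P a f h k) →
            (h F[x].* H) F[x].≡ F[x].1# [mod g a ] →
            F K[x].≡ (M a f h k H K[x].∘ δR) [mod K[x].X K[x].^ q K[x].- K[x].X ] →
            InducesInverse (P a f h k) (P₀ a δ k H F R)
          inverse-case-II p∤n P-perm hH≡1 F≡ = left-inverse⇒inverse P-perm λ x →
            let t , Gx≈ = coordinate x in begin
            P₀ᵉ (Pᵉ x)
              ≈⟨ P₀∘P Gx≈ ⟩
            eval F (ι (φ t)) + B t + Λ (h F[x].* H) x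
              ≈⟨ +-cong (+-congʳ (F[φt]≈ t)) (Λ[hH]≈ Gx≈) ⟩
            A t + ι a * (δ * ι t) * ι c + B t + (x + ι e[a] * (δ * ι t))
              ≈⟨ solve 7 (λ A a y c B x e → (A :+ a :* y :* c :+ B :+ (x :+ e :* y)) := (A :+ B :+ (a :* c :+ e) :* y :+ x))
                   refl (A t) (ι a) (δ * ι t) (ι c) (B t) x (ι e[a]) ⟩
            A t + B t + (ι a * ι c + ι e[a]) * (δ * ι t) + x
              ≈⟨ +-congʳ (+-cong (-B+B≈0 t) (trans (*-congʳ ac+e≈0) (zeroˡ _))) ⟩
            0# + 0# + x
              ≈⟨ trans (+-congʳ (+-identityˡ 0#)) (+-identityˡ x) ⟩
            x ∎
            where
            e    = proj₁ (Fᴰ.mod-elim {h F[x].* H} {F[x].1#} hH≡1)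
            hH≋  = proj₂ (Fᴰ.mod-elim {h F[x].* H} {F[x].1#} hH≡1)
            e[a] = F[x].eval e a
            g[a] = F[x].eval (g a) a
            N    = n F.· F.1#
            c    = (F.1# F.- F[x].eval h a F.* F[x].eval H a) F.* N F.⁻¹

            A : F.Carrier → Carrier
            A t = - κ⁻¹ t * Λ H (eval f (δ * ι t))

            F[φt]≈ : ∀ t → eval F (ι (φ t)) ≈ A t + ι a * (δ * ι t) * ι c
            F[φt]≈ t = begin
              eval F (ι (φ t))
                ≈⟨ eval-mod-x^q-x F (M a f h k H K[x].∘ δR) F≡ (φ t) ⟩
              eval (M a f h k H K[x].∘ δR) (ι (φ t))
                ≈⟨ eval-∘ (M a f h k H) δR (ι (φ t)) ⟩
              eval (M a f h k H) y
                ≈⟨ eval-+ (K[x].- k⁻¹ K[x].* (L H K[x].∘ f)) (K[x].C (ι a) K[x].* K[x].X K[x].* K[x].C (ι c)) y ⟩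
              eval (K[x].- k⁻¹ K[x].* (L H K[x].∘ f)) y + eval (K[x].C (ι a) K[x].* K[x].X K[x].* K[x].C (ι c)) y
                ≈⟨ +-cong
                     (trans (eval-* (K[x].- k⁻¹) (L H K[x].∘ f) y) (*-cong
                       (trans (eval-neg k⁻¹ y) (-‿cong (trans (eval-^ k (q ℕ.∸ 2) y)
                         (^-congˡ (q ℕ.∸ 2) (trans (eval-congʳ k y≈) (k≈κ t))))))
                       (trans (eval-∘ (L H) f y) (trans (eval-L H _) (Λ-cong H (eval-congʳ f y≈))))))
                     (trans (eval-* (K[x].C (ι a) K[x].* K[x].X) (K[x].C (ι c)) y) (*-cong
                       (trans (eval-* (K[x].C (ι a)) K[x].X y) (*-cong (eval-C (ι a) y) (trans (eval-X y) y≈)))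
                       (eval-C (ι c) y))) ⟩
              A t + ι a * (δ * ι t) * ι c ∎
              where
              k⁻¹ = k K[x].^ (q ℕ.∸ 2)
              y   = eval δR (ι (φ t))
              y≈  = eval-δR-φ t

            Λ[hH]≈ : ∀ {x t} → G x ≈ δ * ι t → Λ (h F[x].* H) x ≈ x + ι e[a] * (δ * ι t)
            Λ[hH]≈ {x} {t} Gx≈ = begin
              Λ (h F[x].* H) x                      ≈⟨ Λ-congˡ (h F[x].* H) _ hH≋ ⟩
              Λ (F[x].1# F[x].+ e F[x].* g a) x     ≈⟨ Λ-+ˡ F[x].1# (e F[x].* g a) x ⟩
              Λ F[x].1# x + Λ (e F[x].* g a) x      ≈⟨ +-cong (Λ-1 x) (trans (Λ-* e (g a) x) (Λ-cong e Gx≈)) ⟩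
              x + Λ e (δ * ι t)                     ≈⟨ +-congˡ (Λ-eigen e (δι-eigen t)) ⟩
              x + ι e[a] * (δ * ι t)                ∎

            hH[a]≈ : F[x].eval h a F.* F[x].eval H a F.≈ F.1# F.+ e[a] F.* g[a]
            hH[a]≈ = F-ring.trans (F-ring.sym (Fᴱ.eval-* h H a)) (F-ring.trans
              (Fᴱ.eval-cong (h F[x].* H) (F[x].1# F[x].+ e F[x].* g a) hH≋ F-ring.refl)
              (F-ring.trans (Fᴱ.eval-+ F[x].1# (e F[x].* g a) a) (F-ring.+-cong (Fᴱ.eval-C F.1# a) (Fᴱ.eval-* e (g a) a))))

            ac+e≈0 : ι a * ι c + ι e[a] ≈ 0#
            ac+e≈0 = trans (sym (trans (ι-+ _ _) (+-congʳ (ι-* a c)))) (trans (ι-cong ac+e≈0ᶠ) ι-0)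
              where
              N≉0 : ¬ N F.≈ F.0#
              N≉0 N≈0 = p∤n (n·1≈0⇒p∣n N≈0)

              ac+e≈0ᶠ : a F.* c F.+ e[a] F.≈ F.0#
              ac+e≈0ᶠ = fraction-cancel F.commutativeRing a*g[a]≈n·1 (F.⁻¹-inverseʳ (FF.≉⇒# N≉0)) hH[a]≈

theorem3p9 :
  ∀ {c₁ ℓ₁ ℓ₁′ c₂ ℓ₂ ℓ₂′ : Level} (p r q n : ℕ) →
  Prime p → 0 < r → q ≡ p ^ℕ r → 0 < n →
  (E : FiniteFieldExtension c₁ ℓ₁ ℓ₁′ c₂ ℓ₂ ℓ₂′ q n) →
  let open Extension E in
  (a : F.Carrier) → a F.^ n F.≈ F.1# →
  (δ : K.Carrier) → δ K.# K.0# → δ K.^ q K.≈ ι a K.* δ →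
  (f : K[x].Poly) (h : F[x].Poly) (k : K[x].Poly) →
  (∀ y → ∃ λ z → z F.# F.0# × K[x].eval k (δ K.* ι y) K.≈ ι z) →
  let
    xⁿ-1 = F[x].X F[x].^ n F[x].- F[x].1#
    x^q-x = K[x].X K[x].^ q K[x].- K[x].X
    δR = λ (R : K[x].Poly) → K[x].C δ K[x].* R
    CaseI = λ (H : F[x].Poly) →
      F[x].DegreeBelow n H × (h F[x].* H) F[x].≡ F[x].1# [mod xⁿ-1 ]
    CaseII = λ (H : F[x].Poly) →
      F[x].DegreeBelow (n ∸ 1) H × (h F[x].* H) F[x].≡ F[x].1# [mod g a ]
  in
  (IsPermutationPolynomial (P a f h k) ⇔
    (F[x].Coprime h (g a) × InducesPermutationOfF (Q̄ a δ f h k)))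
  × (p ∣ n → F[x].Coprime h (g a) ⇔ F[x].Coprime h xⁿ-1)
  × (IsPermutationPolynomial (P a f h k) →
      (p ∣ n →
        ∃! F[x]._≈_ CaseI ×
        (∀ R → InducesInverseOnF (Q̄ a δ f h k) R →
         ∀ H → CaseI H →
         ∀ F → F K[x].≡ (K[x].- ((k K[x].∘ δR R) K[x].^ (q ∸ 2))
                          K[x].* (L H K[x].∘ (f K[x].∘ δR R))) [mod x^q-x ] →
         InducesInverse (P a f h k) (P₀ a δ k H F R)))
      × (p ∤ n →
        ∃! F[x]._≈_ CaseII ×
        (∀ R → InducesInverseOnF (Q̄ a δ f h k) R →
         ∀ H → CaseII H →
         ∀ F → F K[x].≡ (M a f h k H K[x].∘ δR R) [mod x^q-x ] →
         InducesInverse (P a f h k) (P₀ a δ k H F R))))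
theorem3p9 p r q n p-prime 0<r q≡p^r 0<n E a aⁿ≈1 δ δ#0 δ-eigen f h k k-unit =
  permutation-criterion f h k k-unit ,
  (λ p∣n → coprime-g⇔coprime-xⁿ-1 p∣n h) ,
  λ P-perm → let coprime = P-permutation⇒coprime f h k k-unit P-perm in
    (λ p∣n →
      -- Condition (1) concerns g_a only; p ∣ n extends it to xⁿ - 1, the modulus of H in this case.
      let s , t , bézout = coprime⇒bézout ≈0? inverse below (Equivalence.to (coprime-g⇔coprime-xⁿ-1 p∣n h) coprime)
      in modular-inverse {s = s} {t} xⁿ-1-degree bézout ,
         λ R (φ , ψ , Q̄≈φ , R≈ψ , φψ-inverse) H (_ , hH≡1) F F≡ →
           inverse-case-I f h k k-unit R H F Q̄≈φ R≈ψ φψ-inverse P-perm hH≡1 F≡) ,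
    (λ p∤n →
      let s , t , bézout = coprime-g⇒bézout coprime
      in modular-inverse {s = s} {t} g-degree bézout ,
         λ R (φ , ψ , Q̄≈φ , R≈ψ , φψ-inverse) H (_ , hH≡1) F F≡ →
           inverse-case-II f h k k-unit R H F Q̄≈φ R≈ψ φψ-inverse p∤n P-perm hH≡1 F≡)
  where
  open Extension E using (module F)
  open FiniteFieldExtension E using (base)
  open LinearizedOperators E p-prime 0<r q≡p^r 0<n
  open Eigenspace a aⁿ≈1 δ δ#0 δ-eigen
  open Division F.commutativeRing
  open HasDegree xⁿ-1-degree using (below)
  open FiniteFieldProperties base
  open Euclid F.commutativeRing
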